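{- For every integer $k\ge 1$ there exists $N_0(k)$ such that the following holds. If $G$ is a $kK_3$-free $4$-partite graph with parts of sizes $n_1\ge n_2\ge n_3\ge n_4\ge 6k^2$ and $n_1+n_2+n_3+n_4\ge N_0(k)$, then $$e(G)\le g_k(n_1,n_2,n_3,n_4).$$ In other words, $\mathrm{ex}(K_{n_1,n_2,n_3,n_4},\,kK_3)\le g_k(n_1,n_2,n_3,n_4)$ for all such $n_1,n_2,n_3,n_4$.
   Context: All graphs are finite and simple, and $e(G)$ denotes the number of edges of $G$. A $4$-partite graph with parts $V_1,V_2,V_3,V_4$ is a graph whose vertex set is the disjoint union of $V_1,\dots,V_4$ and which has no edge inside any $V_i$. $K_{n_1,n_2,n_3,n_4}$ is the complete $4$-partite graph with parts of sizes $n_1,\dots,n_4$. $kK_3$ denotes $k$ vertex-disjoint copies of the triangle $K_3$. A graph $G$ is $F$-free if $G$ does not contain $F$ as a (not necessarily induced) subgraph. $\mathrm{ex}(H,F)$ is the maximum number of edges in an $F$-free subgraph of $H$. For $k\ge 1$ and positive integers $n_1\ge n_2\ge n_3\ge n_4$, define $$g_k(n_1,n_2,n_3,n_4):=\max\{(n_1+n_4)(n_2+n_3)+(k-1)n_1,\; n_1(n_2+n_3+n_4)+(k-1)(n_2+n_3)\}.$$ -}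

module Defs where

open import Data.Fin using (Fin; zero; suc; splitAt; quotient)
open import Data.Fin.Properties using (_≟_; _<?_)
open import Data.List using (List; length; filter; allFin; cartesianProduct)
open import Data.Nat using (ℕ; _+_; _*_; _∸_; _⊔_; _≤_)
open import Data.Product using (_×_; _,_; ∃-syntax; Σ-syntax)
open import Data.Sum using ([_,_]′)
open import Data.Vec using (lookup; _∷_; [])
open import Function using (_∘_; const; Injective)
open import Level using (0ℓ)
open import Relation.Binary using (Rel; Decidable; Symmetric; Irreflexive)
open import Relation.Binary.PropositionalEquality using (_≡_; _≢_; refl; sym)
open import Relation.Nullary using (¬_; ¬?)
open import Relation.Nullary.Decidable using (_×-dec_)

-- Finite simple graphs; the vertex set of a graph of order n is Fin n.
record Graph (n : ℕ) : Set₁ where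
  field
    Adj        : Rel (Fin n) 0ℓ
    adj?       : Decidable Adj
    adj-sym    : Symmetric Adj
    adj-irrefl : Irreflexive _≡_ Adj

open Graph public

-- Each edge is listed once, as the pair of its endpoints in increasing order.
edges : ∀ {n} → Graph n → List (Fin n × Fin n)
edges {n} G =
  filter (λ (u , v) → (u <? v) ×-dec adj? G u v)
         (cartesianProduct (allFin n) (allFin n))

e : ∀ {n} → Graph n → ℕ
e G = length (edges G)

-- F ⊑ G: G has a (not necessarily induced) subgraph isomorphic to F.
record _⊑_ {m n : ℕ} (F : Graph m) (G : Graph n) : Set where
  field
    embed     : Fin m → Fin n
    injective : Injective _≡_ _≡_ embed
    preserves : ∀ {u v} → Adj F u v → Adj G (embed u) (embed v)

infix 4 _⊑_

_-Free_ : ∀ {m n} → Graph m → Graph n → Set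
F -Free G = ¬ (F ⊑ G)

infix 4 _-Free_

-- IsEx H F x: the number ex(H, F) is x.
IsEx : ∀ {n m} → Graph n → Graph m → ℕ → Set₁
IsEx H F x =
  (∃[ p ] Σ[ G ∈ Graph p ] G ⊑ H × F -Free G × e G ≡ x)
  × (∀ {p} (G : Graph p) → G ⊑ H → F -Free G → e G ≤ x)

-- The parts are V₁, …, V₄ with Vᵢ₊₁ the fibre of `part` over i : Fin 4.
record FourPartite {n : ℕ} (G : Graph n) (n₁ n₂ n₃ n₄ : ℕ) : Set where
  field
    part   : Fin n → Fin 4
    proper : ∀ {u v} → Adj G u v → part u ≢ part v
    sizes  : ∀ i → length (filter (λ v → part v ≟ i) (allFin n))
                   ≡ lookup (n₁ ∷ n₂ ∷ n₃ ∷ n₄ ∷ []) i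

-- The first n₁ vertices form the first part, the next n₂ the second, and so on.
block : ∀ n₁ n₂ n₃ n₄ → Fin (n₁ + (n₂ + (n₃ + n₄))) → Fin 4
block n₁ n₂ n₃ n₄ =
  [ const zero
  , [ const (suc zero)
    , [ const (suc (suc zero))
      , const (suc (suc (suc zero)))
      ]′ ∘ splitAt n₃
    ]′ ∘ splitAt n₂
  ]′ ∘ splitAt n₁

K : ∀ n₁ n₂ n₃ n₄ → Graph (n₁ + (n₂ + (n₃ + n₄)))
K n₁ n₂ n₃ n₄ = record
  { Adj        = λ u v → block n₁ n₂ n₃ n₄ u ≢ block n₁ n₂ n₃ n₄ v
  ; adj?       = λ u v → ¬? (block n₁ n₂ n₃ n₄ u ≟ block n₁ n₂ n₃ n₄ v)
  ; adj-sym    = λ p q → p (sym q)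
  ; adj-irrefl = λ { refl p → p refl }
  }

-- k vertex-disjoint triangles: the i-th one is on the vertices 3i, 3i+1, 3i+2.
_K₃ : ∀ k → Graph (k * 3)
k K₃ = record
  { Adj        = λ u v → quotient {k} 3 u ≡ quotient {k} 3 v × u ≢ v
  ; adj?       = λ u v → (quotient {k} 3 u ≟ quotient {k} 3 v) ×-dec ¬? (u ≟ v)
  ; adj-sym    = λ (p , q) → sym p , λ r → q (sym r)
  ; adj-irrefl = λ { refl (_ , q) → q refl }
  }

-- Only used for k ≥ 1, where k ∸ 1 is the true difference.
g : (k n₁ n₂ n₃ n₄ : ℕ) → ℕ
g k n₁ n₂ n₃ n₄ =
    ((n₁ + n₄) * (n₂ + n₃) + (k ∸ 1) * n₁)
  ⊔ (n₁ * (n₂ + n₃ + n₄) + (k ∸ 1) * (n₂ + n₃))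

{-# OPTIONS --safe #-}

-- Induction on k, for κ = k − 1. Call a vertex rich if its link contains 3κ + 1 disjoint edges.
-- Any κ disjoint triangles avoiding a rich vertex v extend to κ + 1 by a triangle at v, so G − v
-- has no κ disjoint triangles, and the degree of v is at most what the bound loses from κ to κ − 1.
-- If no vertex is rich, then the at most 3κ vertices of a maximal triangle packing meet all
-- triangles, and the link of each has a vertex cover of size at most 6κ: deleting at most 18κ²
-- edges leaves a triangle-free graph. Averaging over the transversals of the four parts bounds its
-- size by the largest of the seven cuts (star or 4-cycle) of the complete 4-partite graph.
-- Finally 18κ² is at most κ times the bonus in g, because n₄ ≥ 6k² ≥ 18κ.
--
-- The induction carries seven constants β s, one for each cut s, in place of n₁ and n₂ + n₃ in the
-- bonus terms; this spares re-sorting the part sizes when a vertex is removed.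

module Submission where

open import Defs
open import Data.Bool using (Bool; true; false; if_then_else_; not)
import Data.Bool.Properties as Bool
open import Data.Fin using (Fin; zero; suc; _↑ˡ_; _↑ʳ_; splitAt; combine; quotient; remainder)
open import Data.Fin.Patterns using (0F; 1F; 2F; 3F)
open import Data.Fin.Properties using (_≟_; _<?_; any?; all?; pigeonhole; ¬∀⟶∃¬; <⇒≢; splitAt-↑ˡ; splitAt-↑ʳ; remQuot-combine; combine-remQuot; combine-injective)
open import Data.List using (List; []; _∷_; _++_; length; map; filter; allFin; tabulate; cartesianProduct)
open import Data.List.Membership.Propositional using (_∈_; _∉_)
open import Data.List.Membership.Propositional.Properties using (∈-∃++; ∈-tabulate⁺; ∈-filter⁻; ∈-allFin; ∈-map⁺; ∈-++⁺ˡ; ∈-++⁺ʳ)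
open import Data.List.Properties using (length-tabulate; length-++; length-map; map-tabulate)
open import Data.List.Relation.Binary.Permutation.Propositional using (_↭_; ↭-sym; ↭⇒↭ₛ)
open import Data.List.Relation.Binary.Permutation.Propositional.Properties using (shift; ∈-resp-↭) renaming (map⁺ to ↭-map⁺)
open import Data.List.Relation.Binary.Permutation.Setoid.Properties using (Unique-resp-↭)
open import Data.List.Relation.Unary.AllPairs using (_∷_)
open import Data.List.Relation.Unary.Any using (here; there)
open import Data.List.Relation.Unary.Unique.Propositional using (Unique)
open import Data.List.Relation.Unary.Unique.Propositional.Properties using (allFin⁺; cartesianProduct⁺; filter⁺; map⁺; Unique[x∷xs]⇒x∉xs)
open import Data.Nat using (ℕ; zero; suc; _+_; _*_; _^_; _≤_; _<_; _≥_; z≤n; s≤s)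
open import Data.Nat.ListAction using (sum)
open import Data.Nat.ListAction.Properties using (sum-↭)
open import Data.Nat.Properties hiding (_≟_; _<?_; <⇒≢)
open import Data.Nat.Tactic.RingSolver using (solve-∀)
open import Data.Product using (_×_; _,_; proj₁; proj₂; ∃-syntax)
open import Data.Product.Properties using (≡-dec)
open import Data.Sum using ([_,_]′)
open import Data.Vec as Vec using (lookup)
import Data.Vec.Functional as Vector
open Vector using (Vector)
open import Function using (_∘_; const; id)
open import Relation.Binary.PropositionalEquality
open import Relation.Nullary using (¬_; Dec; yes; no; does; contradiction)
open import Relation.Nullary.Decidable using (¬¬-excluded-middle; decidable-stable; from-yes; _×-dec_; ¬?)

-- Finite sums over lists.

private variable
  A A′ : Set

∑ : (A → ℕ) → List A → ℕ
∑ f xs = sum (map f xs)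

∑-cong : ∀ {f g : A → ℕ} → (∀ x → f x ≡ g x) → ∀ xs → ∑ f xs ≡ ∑ g xs
∑-cong f≗g []       = refl
∑-cong f≗g (x ∷ xs) = cong₂ _+_ (f≗g x) (∑-cong f≗g xs)

∑-cong-∈ : ∀ {f g : A → ℕ} xs → (∀ {x} → x ∈ xs → f x ≡ g x) → ∑ f xs ≡ ∑ g xs
∑-cong-∈ []       f≗g = refl
∑-cong-∈ (x ∷ xs) f≗g = cong₂ _+_ (f≗g (here refl)) (∑-cong-∈ xs (f≗g ∘ there))

∑-mono : ∀ {f g : A → ℕ} xs → (∀ {x} → x ∈ xs → f x ≤ g x) → ∑ f xs ≤ ∑ g xs
∑-mono []       f≤g = z≤n
∑-mono (x ∷ xs) f≤g = +-mono-≤ (f≤g (here refl)) (∑-mono xs (f≤g ∘ there))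

∑-zero : ∀ {f : A → ℕ} xs → (∀ {x} → x ∈ xs → f x ≡ 0) → ∑ f xs ≡ 0
∑-zero []       f≡0 = refl
∑-zero (x ∷ xs) f≡0 = cong₂ _+_ (f≡0 (here refl)) (∑-zero xs (f≡0 ∘ there))

∑-const : ∀ c (xs : List A) → ∑ (λ _ → c) xs ≡ length xs * c
∑-const c []       = refl
∑-const c (x ∷ xs) = cong (c +_) (∑-const c xs)

∑-allFin-const : ∀ n c → ∑ (λ _ → c) (allFin n) ≡ n * c
∑-allFin-const n c = trans (∑-const c (allFin n)) (cong (_* c) (length-tabulate {n = n} id))

interchange : ∀ a b c d → (a + b) + (c + d) ≡ (a + c) + (b + d)
interchange = solve-∀

∑-+ : ∀ (f g : A → ℕ) xs → ∑ (λ x → f x + g x) xs ≡ ∑ f xs + ∑ g xs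
∑-+ f g []       = refl
∑-+ f g (x ∷ xs) = trans (cong (f x + g x +_) (∑-+ f g xs)) (interchange (f x) (g x) _ _)

∑-* : ∀ c (f : A → ℕ) xs → ∑ (λ x → c * f x) xs ≡ c * ∑ f xs
∑-* c f []       = sym (*-zeroʳ c)
∑-* c f (x ∷ xs) = trans (cong (c * f x +_) (∑-* c f xs)) (sym (*-distribˡ-+ c (f x) _))

∑-comm : ∀ (f : A → A′ → ℕ) xs ys →
         ∑ (λ x → ∑ (f x) ys) xs ≡ ∑ (λ y → ∑ (λ x → f x y) xs) ys
∑-comm f []       ys = sym (∑-zero ys (λ _ → refl))
∑-comm f (x ∷ xs) ys =
  trans (cong (∑ (f x) ys +_) (∑-comm f xs ys)) (sym (∑-+ (f x) (λ y → ∑ (λ z → f z y) xs) ys))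

∑-↭ : ∀ (f : A → ℕ) {xs ys} → xs ↭ ys → ∑ f xs ≡ ∑ f ys
∑-↭ f p = sum-↭ (↭-map⁺ f p)

∑-++ : ∀ (f : A → ℕ) xs ys → ∑ f (xs ++ ys) ≡ ∑ f xs + ∑ f ys
∑-++ f []       ys = refl
∑-++ f (x ∷ xs) ys = trans (cong (f x +_) (∑-++ f xs ys)) (sym (+-assoc (f x) _ _))

∑-map : ∀ (f : A′ → ℕ) (h : A → A′) xs → ∑ f (map h xs) ≡ ∑ (f ∘ h) xs
∑-map f h []       = refl
∑-map f h (x ∷ xs) = cong (f (h x) +_) (∑-map f h xs)

-- An average is at most the maximum: weight the chosen element by the length of the list.
-- For the empty list any element of A will do, as it gets weight 0.
∑-average : ∀ (xs : List A) (f : A → ℕ) {c B} → A →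
            (∀ x → length xs * f x + c ≤ B) → ∑ f xs + c ≤ B
∑-average []           f x₀ bound = bound x₀
∑-average xs@(_ ∷ xs′) f {c} {B} x₀ bound = *-cancelˡ-≤ n (begin
  n * (∑ f xs + c)                  ≡⟨ *-distribˡ-+ n (∑ f xs) c ⟩
  n * ∑ f xs + n * c                ≡⟨ cong₂ _+_ (sym (∑-* n f xs)) (sym (∑-const c xs)) ⟩
  ∑ (λ x → n * f x) xs + ∑ (λ _ → c) xs ≡⟨ ∑-+ (λ x → n * f x) (λ _ → c) xs ⟨
  ∑ (λ x → n * f x + c) xs          ≤⟨ ∑-mono xs (λ {x} _ → bound x) ⟩
  ∑ (λ _ → B) xs                    ≡⟨ ∑-const B xs ⟩
  n * B                             ∎)
  where open ≤-Reasoning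
        n = length xs

-- Indicators of decidable propositions and counting.

⟦_⟧ : ∀ {P : Set} → Dec P → ℕ
⟦ P? ⟧ = if does P? then 1 else 0

⟦⟧≤1 : ∀ {P : Set} (P? : Dec P) → ⟦ P? ⟧ ≤ 1
⟦⟧≤1 (yes _) = s≤s z≤n
⟦⟧≤1 (no  _) = z≤n

⟦⟧-yes : ∀ {P : Set} (P? : Dec P) → P → ⟦ P? ⟧ ≡ 1
⟦⟧-yes (yes _) p = refl
⟦⟧-yes (no ¬p) p = contradiction p ¬p

⟦⟧-no : ∀ {P : Set} (P? : Dec P) → ¬ P → ⟦ P? ⟧ ≡ 0
⟦⟧-no (yes p) ¬p = contradiction p ¬p
⟦⟧-no (no _)  ¬p = refl

⟦⟧-mono : ∀ {P Q : Set} (P? : Dec P) (Q? : Dec Q) → (P → Q) → ⟦ P? ⟧ ≤ ⟦ Q? ⟧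
⟦⟧-mono (yes p) Q? f = ≤-reflexive (sym (⟦⟧-yes Q? (f p)))
⟦⟧-mono (no _)  Q? f = z≤n

⟦⟧-cong : ∀ {P Q : Set} (P? : Dec P) (Q? : Dec Q) → (P → Q) → (Q → P) → ⟦ P? ⟧ ≡ ⟦ Q? ⟧
⟦⟧-cong P? Q? f g = ≤-antisym (⟦⟧-mono P? Q? f) (⟦⟧-mono Q? P? g)

⟦⟧-disjoint : ∀ {P Q R : Set} (P? : Dec P) (Q? : Dec Q) (R? : Dec R) →
              (P → R) → (Q → R) → (P → ¬ Q) → ⟦ P? ⟧ + ⟦ Q? ⟧ ≤ ⟦ R? ⟧
⟦⟧-disjoint P?@(yes p) Q? R? f g h =
  ≤-trans (≤-reflexive (cong suc (⟦⟧-no Q? (h p)))) (⟦⟧-mono P? R? f)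
⟦⟧-disjoint (no _)     Q? R? f g h = ⟦⟧-mono Q? R? g

∑-filter : ∀ {P : A → Set} (P? : ∀ x → Dec (P x)) (f : A → ℕ) xs →
           ∑ f (filter P? xs) ≡ ∑ (λ x → ⟦ P? x ⟧ * f x) xs
∑-filter P? f []       = refl
∑-filter P? f (x ∷ xs) with P? x
... | yes _ = cong₂ _+_ (sym (+-identityʳ (f x))) (∑-filter P? f xs)
... | no  _ = ∑-filter P? f xs

length-filter-∑ : ∀ {P : A → Set} (P? : ∀ x → Dec (P x)) xs →
                  length (filter P? xs) ≡ ∑ (λ x → ⟦ P? x ⟧) xs
length-filter-∑ P? []       = refl
length-filter-∑ P? (x ∷ xs) with P? x
... | yes _ = cong suc (length-filter-∑ P? xs)
... | no  _ = length-filter-∑ P? xs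

-- Ordered pairs are counted. On a duplicate-free list paired with itself, a symmetric irreflexive
-- relation has each edge counted twice, whence the factors 2 in the bounds below.
doubleSum : {R : A → A → Set} → (∀ x y → Dec (R x y)) → List A → List A → ℕ
doubleSum R? xs ys = ∑ (λ x → ∑ (λ y → ⟦ R? x y ⟧) ys) xs

-- Packings of disjoint tuples and hitting sets.

module _ {n : ℕ} where

  open import Data.List.Membership.DecPropositional (_≟_ {n}) using (_∈?_)

  -- Disjointness is between different tuples: entries of a single tuple may coincide.
  record Packing {r} (Q : Vector (Fin n) r → Set) (m : ℕ) : Set where
    field
      tuple    : Fin m → Vector (Fin n) r
      holds    : ∀ i → Q (tuple i)
      disjoint : ∀ {i i′ j j′} → tuple i j ≡ tuple i′ j′ → i ≡ i′

  open Packing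

  vertices : ∀ {r m} {Q : Vector (Fin n) r → Set} → Packing Q m → List (Fin n)
  vertices {r} {m} M = tabulate {n = m * r} (λ x → tuple M (quotient r x) (remainder {m} r x))

  ∈-vertices : ∀ {r m} {Q : Vector (Fin n) r → Set} (M : Packing Q m) i j →
               tuple M i j ∈ vertices M
  ∈-vertices {r} M i j = subst (_∈ vertices M)
    (cong (λ (i′ , j′) → tuple M i′ j′) (remQuot-combine i j))
    (∈-tabulate⁺ (combine i j))

  Hits : ∀ {r} → List (Fin n) → (Vector (Fin n) r → Set) → Set
  Hits C Q = ∀ τ → Q τ → ∃[ j ] τ j ∈ C

  empty : ∀ {r} {Q : Vector (Fin n) r → Set} → Packing Q 0
  empty = record { tuple = λ () ; holds = λ () ; disjoint = λ { {()} } }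

  extend : ∀ {r m} {Q : Vector (Fin n) r → Set} (M : Packing Q m) (τ : Vector (Fin n) r) → Q τ →
           (∀ i j j′ → tuple M i j ≢ τ j′) → Packing Q (suc m)
  extend {r} {m} {Q} M τ Qτ fresh = record
    { tuple = t ; holds = h ; disjoint = λ {i} {i′} → d i i′ }
    where
    t : Fin (suc m) → Vector (Fin n) r
    t zero    = τ
    t (suc i) = tuple M i
    h : ∀ i → Q (t i)
    h zero    = Qτ
    h (suc i) = holds M i
    d : ∀ i i′ {j j′} → t i j ≡ t i′ j′ → i ≡ i′
    d zero    zero     eq = refl
    d zero    (suc i′) eq = contradiction (sym eq) (fresh i′ _ _)
    d (suc i) zero     eq = contradiction eq (fresh i _ _)
    d (suc i) (suc i′) eq = cong suc (disjoint M eq)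

  -- A tuple disjoint from all of `M` would extend it to a larger packing.
  vertices-hit : ∀ {r m} {Q : Vector (Fin n) r → Set} (M : Packing Q m) →
                 ¬ Packing Q (suc m) → Hits (vertices M) Q
  vertices-hit M maximal τ Qτ with any? (λ j → τ j ∈? vertices M)
  ... | yes hit = hit
  ... | no ¬hit = contradiction
    (extend M τ Qτ (λ i j j′ eq → ¬hit (j′ , subst (_∈ vertices M) eq (∈-vertices M i j)))) maximal

  -- Lowering `m` until a packing of that size exists yields a maximal one, whose vertices form the
  -- hitting set; the empty packing ends the search. Since `Q` is arbitrary, existence of a packing
  -- is decided only under a double negation, which the conclusion inherits.
  ¬packing⇒hitting-set : ∀ {r} (Q : Vector (Fin n) r → Set) m → ¬ Packing Q (suc m) →
                         ¬ ¬ (∃[ C ] length C ≤ m * r × Hits C Q)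
  ¬packing⇒hitting-set {r} Q m ¬M k = ¬¬-excluded-middle (λ M? → k′ m ¬M M? k)
    where
    k′ : ∀ m → ¬ Packing Q (suc m) → Dec (Packing Q m) →
         ¬ ¬ (∃[ C ] length C ≤ m * r × Hits C Q)
    k′ m       ¬M (yes M) k = k (vertices M , ≤-reflexive (length-tabulate _) , vertices-hit M ¬M)
    k′ zero    ¬M (no ¬M′) k = ¬M′ empty
    k′ (suc m) ¬M (no ¬M′) k = ¬packing⇒hitting-set Q m ¬M′
      λ (C , short , hits) → k (C , ≤-trans short (*-monoˡ-≤ r (n≤1+n m)) , hits)

  -- Each vertex of M lies in at most one tuple of N.
  avoiding-tuple : ∀ {r s m p} {Q : Vector (Fin n) r → Set} {R : Vector (Fin n) s → Set}
                   (M : Packing Q m) (N : Packing R p) → m * r < p →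
                   ∃[ i ] (∀ j i′ j′ → tuple N i j ≢ tuple M i′ j′)
  avoiding-tuple {r} {m = m} {p} M N m*r<p = let (i , avoids) = search in
    i , λ j i′ j′ eq → avoids (j , i′ , j′ , eq)
    where
    Meets : Fin p → Set
    Meets i = ∃[ j ] ∃[ i′ ] ∃[ j′ ] tuple N i j ≡ tuple M i′ j′
    meets? : ∀ i → Dec (Meets i)
    meets? i = any? λ j → any? λ i′ → any? λ j′ → tuple N i j ≟ tuple M i′ j′
    meeting-vertex : (∀ i → Meets i) → Fin p → Fin (m * r)
    meeting-vertex meets i = let (_ , i′ , j′ , _) = meets i in combine i′ j′
    not-all : ¬ (∀ i → Meets i)
    not-all meets
      with i , i₁ , i<i₁ , eq ← pigeonhole m*r<p (meeting-vertex meets)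
      with j , i′ , j′ , eq′ ← meets i | j₁ , i₁′ , j₁′ , eq₁ ← meets i₁
      with refl , refl ← combine-injective i′ j′ i₁′ j₁′ eq
      = <⇒≢ i<i₁ (disjoint N (trans eq′ (sym eq₁)))
    search : ∃[ i ] ¬ Meets i
    search = ¬∀⟶∃¬ p Meets meets? not-all

-- Triangle packings, links and the deletion of all triangles.

module Triangles {n : ℕ} (G : Graph n) where

  open Packing

  -- The list `L` is the current vertex set: removing a vertex shortens the list and leaves the
  -- graph and its vertex type unchanged.
  Triangle : List (Fin n) → Vector (Fin n) 3 → Set
  Triangle L τ = (∀ {i j} → i ≢ j → Adj G (τ i) (τ j)) × (∀ i → τ i ∈ L)

  -- An edge of the link is a pair that completes `v` to a triangle inside `L`; it therefore also
  -- witnesses `v ∈ L`.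
  Link : List (Fin n) → Fin n → Vector (Fin n) 2 → Set
  Link L v τ = Triangle L (v Vector.∷ τ)

  triangle : ∀ {L x y z} → Adj G x y → Adj G x z → Adj G y z → x ∈ L → y ∈ L → z ∈ L →
             Triangle L (x Vector.∷ y Vector.∷ z Vector.∷ Vector.[])
  triangle {L} {x} {y} {z} xy xz yz x∈ y∈ z∈ = adj , member
    where
    τ : Vector (Fin n) 3
    τ = x Vector.∷ y Vector.∷ z Vector.∷ Vector.[]
    adj : ∀ {i j} → i ≢ j → Adj G (τ i) (τ j)
    adj {0F} {0F} i≢j = contradiction refl i≢j
    adj {0F} {1F} _   = xy
    adj {0F} {2F} _   = xz
    adj {1F} {0F} _   = adj-sym G xy
    adj {1F} {1F} i≢j = contradiction refl i≢j
    adj {1F} {2F} _   = yz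
    adj {2F} {0F} _   = adj-sym G xz
    adj {2F} {1F} _   = adj-sym G yz
    adj {2F} {2F} i≢j = contradiction refl i≢j
    member : ∀ i → τ i ∈ L
    member 0F = x∈
    member 1F = y∈
    member 2F = z∈

  -- Entries of different tuples differ by disjointness. Entries at different positions of one tuple
  -- are adjacent, hence differ by irreflexivity.
  packing⇒⊑ : ∀ {k L} → Packing (Triangle L) k → k K₃ ⊑ G
  packing⇒⊑ {k} M = record
    { embed     = λ x → tuple M (quotient 3 x) (remainder {k} 3 x)
    ; injective = injective
    ; preserves = λ {x} {y} (q≡ , x≢y) → subst
        (λ i → Adj G (tuple M (quotient 3 x) (remainder {k} 3 x)) (tuple M i (remainder {k} 3 y)))
        q≡ (proj₁ (holds M _) (λ r≡ → x≢y (remQuot-injective q≡ r≡)))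
    }
    where
    remQuot-injective : ∀ {x y} → quotient {k} 3 x ≡ quotient 3 y →
                        remainder {k} 3 x ≡ remainder {k} 3 y → x ≡ y
    remQuot-injective {x} {y} q≡ r≡ = trans (sym (combine-remQuot {k} 3 x))
      (trans (cong₂ combine q≡ r≡) (combine-remQuot {k} 3 y))
    injective : ∀ {x y} → tuple M (quotient 3 x) (remainder {k} 3 x) ≡
                          tuple M (quotient 3 y) (remainder {k} 3 y) → x ≡ y
    injective {x} {y} eq with quotient {k} 3 x in qx | quotient {k} 3 y in qy
    ... | i | i′ with refl ← disjoint M eq with remainder {k} 3 x ≟ remainder {k} 3 y
    ... | yes r≡ = remQuot-injective (trans qx (sym qy)) r≡
    ... | no r≢  = contradiction (proj₁ (holds M i) r≢) (adj-irrefl G eq)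

  -- One of the 3κ + 1 disjoint edges in the link of v avoids the κ triangles of M.
  add-triangle : ∀ {κ L L′ v} → (∀ {x} → x ∈ L′ → x ∈ L) → v ∉ L′ →
                 Packing (Link L v) (suc (κ * 3)) → Packing (Triangle L′) κ →
                 Packing (Triangle L) (suc κ)
  add-triangle {κ} {L} {L′} {v} L′⊆L v∉L′ N M = extend M′ (v Vector.∷ tuple N i) (holds N i) fresh
    where
    M′ : Packing (Triangle L) κ
    M′ = record { tuple = tuple M ; disjoint = disjoint M
                ; holds = λ i → let (adj , member) = holds M i in adj , λ j → L′⊆L (member j) }
    free-edge : ∃[ i ] (∀ j i′ j′ → tuple N i j ≢ tuple M i′ j′)
    free-edge = avoiding-tuple M N ≤-refl
    i : Fin (suc (κ * 3))
    i = proj₁ free-edge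
    fresh : ∀ i′ j′ j → tuple M i′ j′ ≢ (v Vector.∷ tuple N i) j
    fresh i′ j′ zero    eq = v∉L′ (subst (_∈ L′) eq (proj₂ (holds M i′) j′))
    fresh i′ j′ (suc j) eq = proj₂ free-edge j i′ j′ (sym eq)

  open import Data.List.Membership.DecPropositional (≡-dec (_≟_ {n}) (_≟_ {n})) as Pairs using ()
  open import Data.List.Membership.DecPropositional (_≟_ {n}) using (_∈?_)

  -- Both orientations of a pair must avoid `D`, so the relation is symmetric even though `D` lists
  -- pairs in one orientation only.
  Kept : List (Fin n) → List (Fin n × Fin n) → Fin n → Fin n → Set
  Kept L D u v = Adj G u v × (u ∈ L × v ∈ L) × ((u , v) ∉ D × (v , u) ∉ D)

  kept? : ∀ L D u v → Dec (Kept L D u v)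
  kept? L D u v = adj? G u v ×-dec ((u ∈? L) ×-dec (v ∈? L)) ×-dec
                  (¬? ((u , v) Pairs.∈? D) ×-dec ¬? ((v , u) Pairs.∈? D))

  kept-sym : ∀ {L D u v} → Kept L D u v → Kept L D v u
  kept-sym (uv , (u∈ , v∈) , (uv∉ , vu∉)) = adj-sym G uv , (v∈ , u∈) , (vu∉ , uv∉)

  -- D consists of the pairs (w , x) with w in a maximal triangle packing and x in a vertex
  -- cover of the link of w.
  triangle-transversal : ∀ κ L → ¬ Packing (Triangle L) (suc κ) →
    (∀ v → v ∈ L → ¬ Packing (Link L v) (suc (κ * 3))) →
    ¬ ¬ (∃[ D ] length D ≤ κ * 3 * (κ * 3 * 2) ×
                (∀ {x y z} → Kept L D x y → Kept L D x z → ¬ Kept L D y z))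
  triangle-transversal κ L ¬M poor k =
    ¬packing⇒hitting-set (Triangle L) κ ¬M λ (W , short , hits) →
    cover W λ (D , size , covers) → k
      (D , ≤-trans size (*-monoˡ-≤ (κ * 3 * 2) short) , triangle-free hits covers)
    where
    Covers : List (Fin n) → List (Fin n × Fin n) → Set
    Covers W D = ∀ {w} → w ∈ W → ∀ τ → Link L w τ → ∃[ j ] (w , τ j) ∈ D

    cover : ∀ W → ¬ ¬ (∃[ D ] length D ≤ length W * (κ * 3 * 2) × Covers W D)
    cover []      k = k ([] , z≤n , λ ())
    cover (w ∷ W) k with w ∈? L
    -- The link of a vertex outside `L` is empty, so nothing is added to `D`.
    ... | no w∉L = cover W λ (D , size , covers) →
      k (D , ≤-trans size (m≤n+m _ (κ * 3 * 2)) , λ where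
          (here refl) τ (_ , member) → contradiction (member zero) w∉L
          (there w∈)  → covers w∈)
    ... | yes w∈L = cover W λ (D , size , covers) →
      ¬packing⇒hitting-set (Link L w) (κ * 3) (poor w w∈L) λ (C , short , hits) →
      k (map (w ,_) C ++ D
        , ≤-trans (≤-reflexive (trans (length-++ (map (w ,_) C))
                                      (cong (_+ length D) (length-map (w ,_) C))))
                  (+-mono-≤ short size)
        , λ where
          (here refl) τ link → let (j , τj∈C) = hits τ link in j , ∈-++⁺ˡ (∈-map⁺ (w ,_) τj∈C)
          (there w∈)  τ link → let (j , τj∈D) = covers w∈ τ link in
                               j , ∈-++⁺ʳ (map (w ,_) C) τj∈D)

    -- The cover of the link of `w` contains `x` or `y`, and the pair of `w` with that vertex lies
    -- in `D`; so one of the two edges at `w` was deleted.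
    in-no-triangle : ∀ {W D w x y} → Covers W D → w ∈ W →
                     Kept L D w x → Kept L D w y → ¬ Kept L D x y
    in-no-triangle covers w∈W (wx , (w∈ , x∈) , (wx∉ , _)) (wy , (_ , y∈) , (wy∉ , _)) (xy , _)
      with covers w∈W _ (triangle wx wy xy w∈ x∈ y∈)
    ... | 0F , wx∈D = wx∉ wx∈D
    ... | 1F , wy∈D = wy∉ wy∈D

    triangle-free : ∀ {W D} → Hits W (Triangle L) → Covers W D →
                    ∀ {x y z} → Kept L D x y → Kept L D x z → ¬ Kept L D y z
    triangle-free {D = D} hits covers {x} {y} {z} xy xz yz
      with xy′ , (x∈ , y∈) , _ ← xy | xz′ , (_ , z∈) , _ ← xz
      with hits _ (triangle xy′ xz′ (proj₁ yz) x∈ y∈ z∈)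
    ... | 0F , x∈W = in-no-triangle covers x∈W xy xz yz
    ... | 1F , y∈W = in-no-triangle covers y∈W (kept-sym {L} {D} xy) yz xz
    ... | 2F , z∈W = in-no-triangle covers z∈W (kept-sym {L} {D} xz) (kept-sym {L} {D} yz) xy

-- Cuts of the complete 4-partite graph.

-- These are the seven partitions of the four parts into two non-empty sides: `star c` isolates part
-- `c`, and `pairing j` puts part `0F` together with part `suc j`.
data Cut : Set where
  star    : Fin 4 → Cut
  pairing : Fin 3 → Cut

side : Cut → Fin 4 → Bool
side (star c)    i       = does (i ≟ c)
side (pairing j) zero    = true
side (pairing j) (suc i) = does (i ≟ j)

on : Cut → Bool → Fin 4 → ℕ
on s b i = ⟦ side s i Bool.≟ b ⟧

infix 7 _·_
_·_ : (Fin 4 → ℕ) → (Fin 4 → ℕ) → ℕ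
φ · a = ∑ (λ i → φ i * a i) (allFin 4)

sideSize : Cut → Bool → (Fin 4 → ℕ) → ℕ
sideSize s b a = on s b · a

cutSize : Cut → (Fin 4 → ℕ) → ℕ
cutSize s a = sideSize s true a * sideSize s false a

-- With 0-1 values `r`, this is the number of edges of a graph on four vertices blown up by the
-- sizes `a`. The arguments `r` are grouped into the three perfect matchings, which are the
-- complements of the three 4-cycles.
pairSum : (a₀ a₁ a₂ a₃ r₀₁ r₂₃ r₀₂ r₁₃ r₀₃ r₁₂ : ℕ) → ℕ
pairSum a₀ a₁ a₂ a₃ r₀₁ r₂₃ r₀₂ r₁₃ r₀₃ r₁₂ =
  a₀ * a₁ * r₀₁ + a₂ * a₃ * r₂₃ + a₀ * a₂ * r₀₂ + a₁ * a₃ * r₁₃ + a₀ * a₃ * r₀₃ + a₁ * a₂ * r₁₂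

-- The mixed terms are the pairs across the cut. The squares are kept as a separate non-negative
-- summand; for an actual cut their coefficients vanish, since no part lies on both sides.
product-of-sides : ∀ a₀ a₁ a₂ a₃ t₀ t₁ t₂ t₃ f₀ f₁ f₂ f₃ →
  (t₀ * a₀ + (t₁ * a₁ + (t₂ * a₂ + (t₃ * a₃ + 0)))) *
  (f₀ * a₀ + (f₁ * a₁ + (f₂ * a₂ + (f₃ * a₃ + 0)))) ≡
  (a₀ * a₁ * (t₀ * f₁ + t₁ * f₀) + a₂ * a₃ * (t₂ * f₃ + t₃ * f₂) +
   a₀ * a₂ * (t₀ * f₂ + t₂ * f₀) + a₁ * a₃ * (t₁ * f₃ + t₃ * f₁) +
   a₀ * a₃ * (t₀ * f₃ + t₃ * f₀) + a₁ * a₂ * (t₁ * f₂ + t₂ * f₁)) +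
  (a₀ * a₀ * (t₀ * f₀) + a₁ * a₁ * (t₁ * f₁) + a₂ * a₂ * (t₂ * f₂) + a₃ * a₃ * (t₃ * f₃))
product-of-sides = solve-∀

module _ (a : Fin 4 → ℕ) where

  across : Cut → Fin 4 → Fin 4 → ℕ
  across s i j = on s true i * on s false j + on s true j * on s false i

  within-cut : ∀ s {r₀₁ r₂₃ r₀₂ r₁₃ r₀₃ r₁₂} →
    r₀₁ ≤ across s 0F 1F → r₂₃ ≤ across s 2F 3F →
    r₀₂ ≤ across s 0F 2F → r₁₃ ≤ across s 1F 3F →
    r₀₃ ≤ across s 0F 3F → r₁₂ ≤ across s 1F 2F →
    ∃[ s ] pairSum (a 0F) (a 1F) (a 2F) (a 3F) r₀₁ r₂₃ r₀₂ r₁₃ r₀₃ r₁₂ ≤ cutSize s a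
  within-cut s p q r t u v = s , (begin
    _ ≤⟨ +-mono-≤ (+-mono-≤ (+-mono-≤ (+-mono-≤ (+-mono-≤
           (*-monoʳ-≤ (a 0F * a 1F) p) (*-monoʳ-≤ (a 2F * a 3F) q))
           (*-monoʳ-≤ (a 0F * a 2F) r)) (*-monoʳ-≤ (a 1F * a 3F) t))
           (*-monoʳ-≤ (a 0F * a 3F) u)) (*-monoʳ-≤ (a 1F * a 2F) v) ⟩
    _ ≤⟨ m≤m+n _ _ ⟩
    _ ≡⟨ product-of-sides (a 0F) (a 1F) (a 2F) (a 3F)
           (on s true 0F) (on s true 1F) (on s true 2F) (on s true 3F)
           (on s false 0F) (on s false 1F) (on s false 2F) (on s false 3F) ⟨
    cutSize s a ∎)
    where open ≤-Reasoning

  -- A triangle-free graph on four vertices is contained in a 4-cycle or in a star.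
  four-vertices : ∀ {P₀₁ P₂₃ P₀₂ P₁₃ P₀₃ P₁₂ : Set}
    (d₀₁ : Dec P₀₁) (d₂₃ : Dec P₂₃) (d₀₂ : Dec P₀₂) (d₁₃ : Dec P₁₃) (d₀₃ : Dec P₀₃) (d₁₂ : Dec P₁₂) →
    (P₀₁ → P₀₂ → ¬ P₁₂) → (P₀₁ → P₀₃ → ¬ P₁₃) → (P₀₂ → P₀₃ → ¬ P₂₃) → (P₁₂ → P₁₃ → ¬ P₂₃) →
    ∃[ s ] pairSum (a 0F) (a 1F) (a 2F) (a 3F) ⟦ d₀₁ ⟧ ⟦ d₂₃ ⟧ ⟦ d₀₂ ⟧ ⟦ d₁₃ ⟧ ⟦ d₀₃ ⟧ ⟦ d₁₂ ⟧ ≤ cutSize s a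
  four-vertices (no _) (no _) d₀₂ d₁₃ d₀₃ d₁₂ _ _ _ _ =
    within-cut (pairing 0F) z≤n z≤n (⟦⟧≤1 d₀₂) (⟦⟧≤1 d₁₃) (⟦⟧≤1 d₀₃) (⟦⟧≤1 d₁₂)
  four-vertices d₀₁ d₂₃ (no _) (no _) d₀₃ d₁₂ _ _ _ _ =
    within-cut (pairing 1F) (⟦⟧≤1 d₀₁) (⟦⟧≤1 d₂₃) z≤n z≤n (⟦⟧≤1 d₀₃) (⟦⟧≤1 d₁₂)
  four-vertices d₀₁ d₂₃ d₀₂ d₁₃ (no _) (no _) _ _ _ _ =
    within-cut (pairing 2F) (⟦⟧≤1 d₀₁) (⟦⟧≤1 d₂₃) (⟦⟧≤1 d₀₂) (⟦⟧≤1 d₁₃) z≤n z≤n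
  four-vertices d₀₁ (no _) d₀₂ (no _) d₀₃ (no _) _ _ _ _ =
    within-cut (star 0F) (⟦⟧≤1 d₀₁) z≤n (⟦⟧≤1 d₀₂) z≤n (⟦⟧≤1 d₀₃) z≤n
  four-vertices d₀₁ (no _) (no _) d₁₃ (no _) d₁₂ _ _ _ _ =
    within-cut (star 1F) (⟦⟧≤1 d₀₁) z≤n z≤n (⟦⟧≤1 d₁₃) z≤n (⟦⟧≤1 d₁₂)
  four-vertices (no _) d₂₃ d₀₂ (no _) (no _) d₁₂ _ _ _ _ =
    within-cut (star 2F) z≤n (⟦⟧≤1 d₂₃) (⟦⟧≤1 d₀₂) z≤n z≤n (⟦⟧≤1 d₁₂)
  four-vertices (no _) d₂₃ (no _) d₁₃ d₀₃ (no _) _ _ _ _ =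
    within-cut (star 3F) z≤n (⟦⟧≤1 d₂₃) z≤n (⟦⟧≤1 d₁₃) (⟦⟧≤1 d₀₃) z≤n
  four-vertices (yes p) _ (yes q) _ _ (yes r) t _ _ _ = contradiction r (t p q)
  four-vertices (yes p) _ _ (yes r) (yes q) _ _ t _ _ = contradiction r (t p q)
  four-vertices _ (yes r) (yes p) _ (yes q) _ _ _ t _ = contradiction r (t p q)
  four-vertices _ (yes r) _ (yes q) _ (yes p) _ _ _ t = contradiction r (t p q)

-- Averaging over the transversals of four classes.

∑-linear : ∀ {A : Set} a b c (f g h : A → ℕ) xs →
           ∑ (λ x → a * f x + b * g x + c * h x) xs ≡ a * ∑ f xs + b * ∑ g xs + c * ∑ h xs
∑-linear a b c f g h xs =
  trans (∑-+ (λ x → a * f x + b * g x) (λ x → c * h x) xs)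
        (cong₂ _+_ (trans (∑-+ (λ x → a * f x) (λ x → b * g x) xs)
                          (cong₂ _+_ (∑-* a f xs) (∑-* b g xs)))
                   (∑-* c h xs))

transversePairs : ∀ {n} {R : Fin n → Fin n → Set} → (∀ x y → Dec (R x y)) →
                  (Fin 4 → List (Fin n)) → ℕ
transversePairs R? W = m 0F 1F + m 0F 2F + m 0F 3F + m 1F 2F + m 1F 3F + m 2F 3F
  where
  m : Fin 4 → Fin 4 → ℕ
  m i j = doubleSum R? (W i) (W j)

module Averaging {n : ℕ} {R : Fin n → Fin n → Set} (R? : ∀ x y → Dec (R x y))
         (triangle-free : ∀ {x y z} → R x y → R x z → ¬ R y z) where

  private
    between : List (Fin n) → List (Fin n) → ℕ
    between = doubleSum R?

  -- One class after another is replaced by `length (W i)` copies of a single vertex of it; by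
  -- `∑-average` it suffices to bound the result for every choice of that vertex. After four
  -- replacements a weighted triangle-free graph on four vertices is left, which `four-vertices`
  -- places inside a cut. The vertex `v` is the default that `∑-average` asks for when a class is
  -- empty.
  average : (W : Fin 4 → List (Fin n)) → Fin n → ∀ d {B} →
            (∀ s → cutSize s (λ i → length (W i)) + d ≤ B) →
            transversePairs R? W + d ≤ B
  average W v d {B} bound = begin
    between W₀ W₁ + between W₀ W₂ + between W₀ W₃ +
    between W₁ W₂ + between W₁ W₃ + between W₂ W₃ + d
                        ≡⟨ split₀ ⟩
    ∑ f₀ W₀ + c₀        ≤⟨ ∑-average W₀ f₀ v (λ x₀ → begin
    n₀ * f₀ x₀ + c₀     ≡⟨ split₁ x₀ ⟩
    ∑ (f₁ x₀) W₁ + c₁ x₀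
                        ≤⟨ ∑-average W₁ (f₁ x₀) v (λ x₁ → begin
    n₁ * f₁ x₀ x₁ + c₁ x₀
                        ≡⟨ split₂ x₀ x₁ ⟩
    ∑ (f₂ x₀ x₁) W₂ + c₂ x₀ x₁
                        ≤⟨ ∑-average W₂ (f₂ x₀ x₁) v (λ x₂ → begin
    n₂ * f₂ x₀ x₁ x₂ + c₂ x₀ x₁
                        ≡⟨ split₃ x₀ x₁ x₂ ⟩
    ∑ (f₃ x₀ x₁ x₂) W₃ + c₃ x₀ x₁ x₂
                        ≤⟨ ∑-average W₃ (f₃ x₀ x₁ x₂) v (transversal x₀ x₁ x₂) ⟩
    B ∎) ⟩ B ∎) ⟩ B ∎) ⟩ B ∎
    where
    open ≤-Reasoning
    W₀ = W 0F
    W₁ = W 1F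
    W₂ = W 2F
    W₃ = W 3F
    n₀ = length W₀
    n₁ = length W₁
    n₂ = length W₂
    n₃ = length W₃
    r : Fin n → Fin n → ℕ
    r x y = ⟦ R? x y ⟧
    deg₁ deg₂ deg₃ f₀ : Fin n → ℕ
    deg₁ x = ∑ (r x) W₁
    deg₂ x = ∑ (r x) W₂
    deg₃ x = ∑ (r x) W₃
    -- Each `f` is the contribution of one vertex of the class being replaced, and each `c` collects
    -- the terms free of that class. A class already replaced enters with its length as coefficient,
    -- the others with the coefficient 1.
    f₀ x = 1 * deg₁ x + 1 * deg₂ x + 1 * deg₃ x
    f₁ : (x₀ x : Fin n) → ℕ
    f₁ x₀ x = n₀ * r x₀ x + 1 * deg₂ x + 1 * deg₃ x
    f₂ : (x₀ x₁ x : Fin n) → ℕ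
    f₂ x₀ x₁ x = n₀ * r x₀ x + n₁ * r x₁ x + 1 * deg₃ x
    f₃ : (x₀ x₁ x₂ x : Fin n) → ℕ
    f₃ x₀ x₁ x₂ x = n₀ * r x₀ x + n₁ * r x₁ x + n₂ * r x₂ x
    c₀ : ℕ
    c₀ = between W₁ W₂ + between W₁ W₃ + between W₂ W₃ + d
    c₁ : Fin n → ℕ
    c₁ x₀ = n₀ * deg₂ x₀ + n₀ * deg₃ x₀ + between W₂ W₃ + d
    c₂ : (x₀ x₁ : Fin n) → ℕ
    c₂ x₀ x₁ = n₀ * n₁ * r x₀ x₁ + n₀ * deg₃ x₀ + n₁ * deg₃ x₁ + d
    c₃ : (x₀ x₁ x₂ : Fin n) → ℕ
    c₃ x₀ x₁ x₂ = n₀ * n₁ * r x₀ x₁ + n₀ * n₂ * r x₀ x₂ + n₁ * n₂ * r x₁ x₂ + d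

    split₀ : between W₀ W₁ + between W₀ W₂ + between W₀ W₃ +
             between W₁ W₂ + between W₁ W₃ + between W₂ W₃ + d ≡ ∑ f₀ W₀ + c₀
    split₀ = trans
      (arrange (between W₀ W₁) (between W₀ W₂) (between W₀ W₃) (between W₁ W₂) (between W₁ W₃) (between W₂ W₃) d)
      (cong (_+ c₀) (sym (∑-linear 1 1 1 deg₁ deg₂ deg₃ W₀)))
      where
      arrange : ∀ e₀₁ e₀₂ e₀₃ e₁₂ e₁₃ e₂₃ d → e₀₁ + e₀₂ + e₀₃ + e₁₂ + e₁₃ + e₂₃ + d ≡
                1 * e₀₁ + 1 * e₀₂ + 1 * e₀₃ + (e₁₂ + e₁₃ + e₂₃ + d)
      arrange = solve-∀

    split₁ : ∀ x₀ → n₀ * f₀ x₀ + c₀ ≡ ∑ (f₁ x₀) W₁ + c₁ x₀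
    split₁ x₀ = trans
      (arrange n₀ (deg₁ x₀) (deg₂ x₀) (deg₃ x₀) (between W₁ W₂) (between W₁ W₃) (between W₂ W₃) d)
      (cong (_+ c₁ x₀) (sym (∑-linear n₀ 1 1 (r x₀) deg₂ deg₃ W₁)))
      where
      arrange : ∀ n₀ s₁ s₂ s₃ e₁₂ e₁₃ e₂₃ d →
                n₀ * (1 * s₁ + 1 * s₂ + 1 * s₃) + (e₁₂ + e₁₃ + e₂₃ + d) ≡
                n₀ * s₁ + 1 * e₁₂ + 1 * e₁₃ + (n₀ * s₂ + n₀ * s₃ + e₂₃ + d)
      arrange = solve-∀

    split₂ : ∀ x₀ x₁ → n₁ * f₁ x₀ x₁ + c₁ x₀ ≡ ∑ (f₂ x₀ x₁) W₂ + c₂ x₀ x₁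
    split₂ x₀ x₁ = trans
      (arrange n₀ n₁ (r x₀ x₁) (deg₂ x₁) (deg₃ x₁) (deg₂ x₀) (deg₃ x₀) (between W₂ W₃) d)
      (cong (_+ c₂ x₀ x₁) (sym (∑-linear n₀ n₁ 1 (r x₀) (r x₁) deg₃ W₂)))
      where
      arrange : ∀ n₀ n₁ r₀₁ t₂ t₃ s₂ s₃ e₂₃ d →
                n₁ * (n₀ * r₀₁ + 1 * t₂ + 1 * t₃) + (n₀ * s₂ + n₀ * s₃ + e₂₃ + d) ≡
                n₀ * s₂ + n₁ * t₂ + 1 * e₂₃ + (n₀ * n₁ * r₀₁ + n₀ * s₃ + n₁ * t₃ + d)
      arrange = solve-∀

    split₃ : ∀ x₀ x₁ x₂ → n₂ * f₂ x₀ x₁ x₂ + c₂ x₀ x₁ ≡ ∑ (f₃ x₀ x₁ x₂) W₃ + c₃ x₀ x₁ x₂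
    split₃ x₀ x₁ x₂ = trans
      (arrange n₀ n₁ n₂ (r x₀ x₁) (r x₀ x₂) (r x₁ x₂) (deg₃ x₀) (deg₃ x₁) (deg₃ x₂) d)
      (cong (_+ c₃ x₀ x₁ x₂) (sym (∑-linear n₀ n₁ n₂ (r x₀) (r x₁) (r x₂) W₃)))
      where
      arrange : ∀ n₀ n₁ n₂ r₀₁ r₀₂ r₁₂ s₃ t₃ u₃ d →
                n₂ * (n₀ * r₀₂ + n₁ * r₁₂ + 1 * u₃) + (n₀ * n₁ * r₀₁ + n₀ * s₃ + n₁ * t₃ + d) ≡
                n₀ * s₃ + n₁ * t₃ + n₂ * u₃ + (n₀ * n₁ * r₀₁ + n₀ * n₂ * r₀₂ + n₁ * n₂ * r₁₂ + d)
      arrange = solve-∀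

    transversal : ∀ x₀ x₁ x₂ x₃ → n₃ * f₃ x₀ x₁ x₂ x₃ + c₃ x₀ x₁ x₂ ≤ B
    transversal x₀ x₁ x₂ x₃ =
      let s , within = four-vertices (λ i → length (W i))
            (R? x₀ x₁) (R? x₂ x₃) (R? x₀ x₂) (R? x₁ x₃) (R? x₀ x₃) (R? x₁ x₂)
            triangle-free triangle-free triangle-free triangle-free
      in begin
      n₃ * f₃ x₀ x₁ x₂ x₃ + c₃ x₀ x₁ x₂
        ≡⟨ arrange n₀ n₁ n₂ n₃ (r x₀ x₁) (r x₂ x₃) (r x₀ x₂) (r x₁ x₃) (r x₀ x₃) (r x₁ x₂) d ⟩
      pairSum n₀ n₁ n₂ n₃ (r x₀ x₁) (r x₂ x₃) (r x₀ x₂) (r x₁ x₃) (r x₀ x₃) (r x₁ x₂) + d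
        ≤⟨ +-monoˡ-≤ d within ⟩
      cutSize s (λ i → length (W i)) + d
        ≤⟨ bound s ⟩
      B ∎
      where
      arrange : ∀ n₀ n₁ n₂ n₃ r₀₁ r₂₃ r₀₂ r₁₃ r₀₃ r₁₂ d →
        n₃ * (n₀ * r₀₃ + n₁ * r₁₃ + n₂ * r₂₃) +
          (n₀ * n₁ * r₀₁ + n₀ * n₂ * r₀₂ + n₁ * n₂ * r₁₂ + d) ≡
        n₀ * n₁ * r₀₁ + n₂ * n₃ * r₂₃ + n₀ * n₂ * r₀₂ + n₁ * n₃ * r₁₃ + n₀ * n₃ * r₀₃ +
          n₁ * n₂ * r₁₂ + d
      arrange = solve-∀

-- Splitting a vertex list into its four classes.

module Parts {n : ℕ} (part : Fin n → Fin 4) where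

  class : List (Fin n) → Fin 4 → List (Fin n)
  class L i = filter (λ v → part v ≟ i) L

  size : List (Fin n) → Fin 4 → ℕ
  size L i = length (class L i)

  ∑-indicator : ∀ p c → ∑ (λ i → ⟦ p ≟ i ⟧ * c) (allFin 4) ≡ c
  ∑-indicator 0F c = trans (+-identityʳ (c + 0)) (+-identityʳ c)
  ∑-indicator 1F c = trans (+-identityʳ (c + 0)) (+-identityʳ c)
  ∑-indicator 2F c = trans (+-identityʳ (c + 0)) (+-identityʳ c)
  ∑-indicator 3F c = trans (+-identityʳ (c + 0)) (+-identityʳ c)

  ∑-class : ∀ (f : Fin n → ℕ) L → ∑ f L ≡ ∑ (λ i → ∑ f (class L i)) (allFin 4)
  ∑-class f L = begin
    ∑ f L
      ≡⟨ ∑-cong (λ x → ∑-indicator (part x) (f x)) L ⟨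
    ∑ (λ x → ∑ (λ i → ⟦ part x ≟ i ⟧ * f x) (allFin 4)) L
      ≡⟨ ∑-comm (λ x i → ⟦ part x ≟ i ⟧ * f x) L (allFin 4) ⟩
    ∑ (λ i → ∑ (λ x → ⟦ part x ≟ i ⟧ * f x) L) (allFin 4)
      ≡⟨ ∑-cong (λ i → ∑-filter (λ v → part v ≟ i) f L) (allFin 4) ⟨
    ∑ (λ i → ∑ f (class L i)) (allFin 4) ∎
    where open ≡-Reasoning

  ∑-size : ∀ (φ : Fin 4 → ℕ) L → ∑ (φ ∘ part) L ≡ ∑ (λ i → φ i * size L i) (allFin 4)
  ∑-size φ L = trans (∑-class (φ ∘ part) L) (∑-cong constant (allFin 4))
    where
    constant : ∀ i → ∑ (φ ∘ part) (class L i) ≡ φ i * size L i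
    constant i = begin
      ∑ (φ ∘ part) (class L i)
        ≡⟨ ∑-cong-∈ (class L i) (λ x∈ → cong φ (proj₂ (∈-filter⁻ (λ v → part v ≟ i) {xs = L} x∈))) ⟩
      ∑ (λ _ → φ i) (class L i)
        ≡⟨ ∑-const (φ i) (class L i) ⟩
      size L i * φ i
        ≡⟨ *-comm (size L i) (φ i) ⟩
      φ i * size L i ∎
      where open ≡-Reasoning

  module _ {R : Fin n → Fin n → Set} (R? : ∀ x y → Dec (R x y))
           (R-sym : ∀ {x y} → R x y → R y x)
           (proper : ∀ {x y} → R x y → part x ≢ part y) where

    -- Of the sixteen blocks, the four diagonal ones vanish by `proper` and the other twelve agree
    -- in pairs by symmetry.
    double-class : ∀ L →
      doubleSum R? L L ≡ 2 * transversePairs R? (class L)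
    double-class L = begin
      doubleSum R? L L
        ≡⟨ ∑-class _ L ⟩
      ∑ (λ i → doubleSum R? (class L i) L) (allFin 4)
        ≡⟨ ∑-cong (λ i → trans (∑-cong (λ x → ∑-class (λ y → ⟦ R? x y ⟧) L) (class L i))
                               (∑-comm (λ x j → ∑ (λ y → ⟦ R? x y ⟧) (class L j)) (class L i) (allFin 4)))
                  (allFin 4) ⟩
      ∑ (λ i → ∑ (λ j → m i j) (allFin 4)) (allFin 4)
        ≡⟨ expand (diagonal 0F) (diagonal 1F) (diagonal 2F) (diagonal 3F)
                  (swap 0F 1F) (swap 0F 2F) (swap 0F 3F) (swap 1F 2F) (swap 1F 3F) (swap 2F 3F) ⟩
      2 * transversePairs R? (class L) ∎
      where
      open ≡-Reasoning
      m : Fin 4 → Fin 4 → ℕ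
      m i j = doubleSum R? (class L i) (class L j)
      member : ∀ {i x} → x ∈ class L i → part x ≡ i
      member x∈ = proj₂ (∈-filter⁻ _ {xs = L} x∈)
      diagonal : ∀ i → m i i ≡ 0
      diagonal i = ∑-zero (class L i) λ {x} x∈ → ∑-zero (class L i) λ {y} y∈ →
        ⟦⟧-no (R? x y) λ xy → proper xy (trans (member x∈) (sym (member y∈)))
      swap : ∀ i j → m j i ≡ m i j
      swap i j = trans (∑-comm (λ x y → ⟦ R? x y ⟧) (class L j) (class L i))
        (∑-cong (λ y → ∑-cong (λ x → ⟦⟧-cong (R? x y) (R? y x) R-sym R-sym) (class L j)) (class L i))
      arrange : ∀ a b c d e f →
        (0 + (a + (b + (c + 0)))) + ((a + (0 + (d + (e + 0)))) +
        ((b + (d + (0 + (f + 0)))) + ((c + (e + (f + (0 + 0)))) + 0))) ≡ 2 * (a + b + c + d + e + f)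
      arrange = solve-∀
      expand : ∀ {d₀ d₁ d₂ d₃ a b c d e f a′ b′ c′ d′ e′ f′} →
        d₀ ≡ 0 → d₁ ≡ 0 → d₂ ≡ 0 → d₃ ≡ 0 →
        a′ ≡ a → b′ ≡ b → c′ ≡ c → d′ ≡ d → e′ ≡ e → f′ ≡ f →
        (d₀ + (a + (b + (c + 0)))) + ((a′ + (d₁ + (d + (e + 0)))) +
        ((b′ + (d′ + (d₂ + (f + 0)))) + ((c′ + (e′ + (f′ + (d₃ + 0)))) + 0))) ≡ 2 * (a + b + c + d + e + f)
      expand {a = a} {b} {c} {d} {e} {f} refl refl refl refl refl refl refl refl refl refl =
        arrange a b c d e f

    triangle-free-bound : (∀ {x y z} → R x y → R x z → ¬ R y z) → ∀ L d B →
      (∀ s → cutSize s (size L) + d ≤ B) → doubleSum R? L L + 2 * d ≤ 2 * B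
    -- The empty list offers no vertex as the default for `average`; here the sum is `0`, and any
    -- cut gives `d ≤ B`.
    triangle-free-bound triangle-free []        d B bound =
      *-monoʳ-≤ 2 (≤-trans (m≤n+m d _) (bound (star 0F)))
    triangle-free-bound triangle-free L@(v ∷ _) d B bound = begin
      doubleSum R? L L + 2 * d  ≡⟨ cong (_+ 2 * d) (double-class L) ⟩
      2 * p + 2 * d             ≡⟨ *-distribˡ-+ 2 p d ⟨
      2 * (p + d)               ≤⟨ *-monoʳ-≤ 2 (Averaging.average R? triangle-free (class L) v d bound) ⟩
      2 * B                     ∎
      where open ≤-Reasoning
            p = transversePairs R? (class L)

-- Sums over products and sublists.

∑-cartesianProduct : ∀ {A A′ : Set} (f : A × A′ → ℕ) xs ys →
                     ∑ f (cartesianProduct xs ys) ≡ ∑ (λ x → ∑ (λ y → f (x , y)) ys) xs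
∑-cartesianProduct f []       ys = refl
∑-cartesianProduct f (x ∷ xs) ys = trans (∑-++ f (map (x ,_) ys) (cartesianProduct xs ys))
  (cong₂ _+_ (∑-map f (x ,_) ys) (∑-cartesianProduct f xs ys))

remove : ∀ {A : Set} {x : A} {xs} → x ∈ xs → ∃[ xs′ ] xs ↭ x ∷ xs′
remove x∈xs with ys , zs , refl ← ∈-∃++ x∈xs = ys ++ zs , shift _ ys zs

∑-⊆ : ∀ {A : Set} (f : A → ℕ) {xs ys} → Unique xs → (∀ {x} → x ∈ xs → x ∈ ys) → ∑ f xs ≤ ∑ f ys
∑-⊆ f {[]}     _              xs⊆ys = z≤n
∑-⊆ f {x ∷ xs} {ys} x∷xs!@(_ ∷ xs!) xs⊆ys with ys′ , ys↭ ← remove (xs⊆ys (here refl)) = begin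
  f x + ∑ f xs  ≤⟨ +-monoʳ-≤ (f x) (∑-⊆ f xs! xs⊆ys′) ⟩
  f x + ∑ f ys′ ≡⟨ ∑-↭ f ys↭ ⟨
  ∑ f ys        ∎
  where
  open ≤-Reasoning
  xs⊆ys′ : ∀ {z} → z ∈ xs → z ∈ ys′
  xs⊆ys′ z∈xs with ∈-resp-↭ ys↭ (xs⊆ys (there z∈xs))
  ... | here refl   = contradiction z∈xs (Unique[x∷xs]⇒x∉xs x∷xs!)
  ... | there z∈ys′ = z∈ys′

-- The induction on the number of disjoint triangles.

-- Marks the parts in which a vertex of part `h` can have neighbours that the cut `s` does not
-- separate from it.
sameSide : Cut → Fin 4 → Fin 4 → ℕ
sameSide s h i = ⟦ (side s i Bool.≟ side s h) ×-dec ¬? (i ≟ h) ⟧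

module Induction {n : ℕ} (G : Graph n) (part : Fin n → Fin 4)
                 (proper : ∀ {u v} → Adj G u v → part u ≢ part v) where

  open Triangles G
  open Parts part
  open import Data.List.Membership.DecPropositional (≡-dec (_≟_ {n}) (_≟_ {n})) as Pairs using ()

  degreeSum : List (Fin n) → ℕ
  degreeSum L = doubleSum (adj? G) L L

  deg : Fin n → List (Fin n) → ℕ
  deg v L = ∑ (λ x → ⟦ adj? G v x ⟧) L

  pairs-in : ∀ {L} → Unique L → ∀ D →
             ∑ (λ u → ∑ (λ v → ⟦ (u , v) Pairs.∈? D ⟧) L) L ≤ length D
  pairs-in {L} L! D = begin
    ∑ (λ u → ∑ (λ v → ⟦ (u , v) Pairs.∈? D ⟧) L) L
      ≡⟨ ∑-cartesianProduct (λ p → ⟦ p Pairs.∈? D ⟧) L L ⟨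
    ∑ (λ p → ⟦ p Pairs.∈? D ⟧) (cartesianProduct L L)
      ≡⟨ ∑-cong (λ p → *-identityʳ ⟦ p Pairs.∈? D ⟧) (cartesianProduct L L) ⟨
    ∑ (λ p → ⟦ p Pairs.∈? D ⟧ * 1) (cartesianProduct L L)
      ≡⟨ ∑-filter (Pairs._∈? D) (λ _ → 1) (cartesianProduct L L) ⟨
    ∑ (λ _ → 1) (filter (Pairs._∈? D) (cartesianProduct L L))
      ≤⟨ ∑-⊆ (λ _ → 1) (filter⁺ (Pairs._∈? D) (cartesianProduct⁺ L! L!))
           (λ p∈ → proj₂ (∈-filter⁻ (Pairs._∈? D) {xs = cartesianProduct L L} p∈)) ⟩
    ∑ (λ _ → 1) D
      ≡⟨ trans (∑-const 1 D) (*-identityʳ (length D)) ⟩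
    length D ∎
    where open ≤-Reasoning

  -- An adjacent ordered pair is kept, or it or its reverse is listed in `D`; a listed pair thus
  -- accounts for at most two ordered pairs.
  deletion : ∀ {L} → Unique L → ∀ D →
             degreeSum L ≤ doubleSum (kept? L D) L L + 2 * length D
  deletion {L} L! D = begin
    degreeSum L
      ≤⟨ ∑-mono L (λ {u} u∈ → ∑-mono L (λ {v} v∈ → pointwise u∈ v∈)) ⟩
    ∑ (λ u → ∑ (λ v → kept u v + (del u v + del v u)) L) L
      ≡⟨ split kept (λ u v → del u v + del v u) ⟩
    doubleSum (kept? L D) L L + ∑ (λ u → ∑ (λ v → del u v + del v u) L) L
      ≡⟨ cong (doubleSum (kept? L D) L L +_) (split del (λ u v → del v u)) ⟩
    doubleSum (kept? L D) L L + (∑ (λ u → ∑ (del u) L) L + ∑ (λ u → ∑ (λ v → del v u) L) L)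
      ≡⟨ cong (λ l → doubleSum (kept? L D) L L + (∑ (λ u → ∑ (del u) L) L + l)) (∑-comm del L L) ⟨
    doubleSum (kept? L D) L L + (∑ (λ u → ∑ (del u) L) L + ∑ (λ u → ∑ (del u) L) L)
      ≤⟨ +-monoʳ-≤ (doubleSum (kept? L D) L L) (+-mono-≤ (pairs-in L! D) (pairs-in L! D)) ⟩
    doubleSum (kept? L D) L L + (length D + length D)
      ≡⟨ cong (λ l → doubleSum (kept? L D) L L + (length D + l)) (+-identityʳ (length D)) ⟨
    doubleSum (kept? L D) L L + 2 * length D ∎
    where
    open ≤-Reasoning
    kept del : Fin n → Fin n → ℕ
    kept u v = ⟦ kept? L D u v ⟧
    del u v = ⟦ (u , v) Pairs.∈? D ⟧
    split : ∀ (f h : Fin n → Fin n → ℕ) →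
            ∑ (λ u → ∑ (λ v → f u v + h u v) L) L ≡ ∑ (λ u → ∑ (f u) L) L + ∑ (λ u → ∑ (h u) L) L
    split f h = trans (∑-cong (λ u → ∑-+ (f u) (h u) L) L) (∑-+ (λ u → ∑ (f u) L) (λ u → ∑ (h u) L) L)
    pointwise : ∀ {u v} → u ∈ L → v ∈ L → ⟦ adj? G u v ⟧ ≤ kept u v + (del u v + del v u)
    pointwise {u} {v} u∈ v∈ = cases ((u , v) Pairs.∈? D) ((v , u) Pairs.∈? D)
      where
      cases : (d₁ : Dec ((u , v) ∈ D)) (d₂ : Dec ((v , u) ∈ D)) →
              ⟦ adj? G u v ⟧ ≤ kept u v + (⟦ d₁ ⟧ + ⟦ d₂ ⟧)
      cases (yes _)  d₂       = ≤-trans (⟦⟧≤1 (adj? G u v)) (m≤n⇒m≤o+n (kept u v) (m≤m+n 1 ⟦ d₂ ⟧))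
      cases (no _)   (yes _)  = ≤-trans (⟦⟧≤1 (adj? G u v)) (m≤n+m 1 (kept u v))
      cases (no uv∉) (no vu∉) = ≤-trans
        (⟦⟧-mono (adj? G u v) (kept? L D u v) (λ uv → uv , (u∈ , v∈) , (uv∉ , vu∉))) (m≤m+n _ 0)

  slack : Cut → Fin 4 → List (Fin n) → ℕ
  slack s h L = ∑ (sameSide s h ∘ part) L

  -- A neighbour of `v` lies on the opposite side of the cut, or on the same side but, by `proper`,
  -- in another part.
  deg≤ : ∀ s v L → deg v L ≤ sideSize s (not (side s (part v))) (size L) + slack s (part v) L
  deg≤ s v L = begin
    deg v L
      ≤⟨ ∑-mono L (λ {x} _ → pointwise x) ⟩
    ∑ (λ x → on s (not (side s (part v))) (part x) + sameSide s (part v) (part x)) L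
      ≡⟨ ∑-+ (on s (not (side s (part v))) ∘ part) (sameSide s (part v) ∘ part) L ⟩
    ∑ (on s (not (side s (part v))) ∘ part) L + slack s (part v) L
      ≡⟨ cong (_+ slack s (part v) L) (∑-size (on s (not (side s (part v)))) L) ⟩
    sideSize s (not (side s (part v))) (size L) + slack s (part v) L ∎
    where
    open ≤-Reasoning
    pointwise : ∀ x → ⟦ adj? G v x ⟧ ≤ on s (not (side s (part v))) (part x) + sameSide s (part v) (part x)
    pointwise x with adj? G v x
    ... | no _   = z≤n
    ... | yes vx with side s (part x) Bool.≟ side s (part v)
    ...   | yes _  = ≤-trans
      (≤-reflexive (sym (⟦⟧-yes (¬? (part x ≟ part v)) (proper vx ∘ sym)))) (m≤n+m _ _)
    ...   | no neq = ≤-trans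
      (≤-reflexive (sym (⟦⟧-yes (side s (part x) Bool.≟ not (side s (part v))) (Bool.¬-not neq))))
      (m≤m+n _ _)

  sideSize-remove : ∀ {L v L′} → L ↭ v ∷ L′ → ∀ s b →
                    sideSize s b (size L) ≡ on s b (part v) + sideSize s b (size L′)
  sideSize-remove {L} {v} {L′} L↭ s b = begin
    sideSize s b (size L)                    ≡⟨ ∑-size (on s b) L ⟨
    ∑ (on s b ∘ part) L                      ≡⟨ ∑-↭ (on s b ∘ part) L↭ ⟩
    on s b (part v) + ∑ (on s b ∘ part) L′   ≡⟨ cong (on s b (part v) +_) (∑-size (on s b) L′) ⟩
    on s b (part v) + sideSize s b (size L′) ∎
    where open ≡-Reasoning

  -- Taking one vertex off a side lowers the product of the sides by the opposite side, which has
  -- the same size for `L` and `L′`.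
  cutSize-remove : ∀ {L v L′} → L ↭ v ∷ L′ → ∀ s →
                   cutSize s (size L) ≡ cutSize s (size L′) + sideSize s (not (side s (part v))) (size L′)
  cutSize-remove {L} {v} {L′} L↭ s =
    trans (cong₂ _*_ (sideSize-remove L↭ s true) (sideSize-remove L↭ s false)) (by-side (side s (part v)))
    where
    X = sideSize s true (size L′)
    Y = sideSize s false (size L′)
    by-side : ∀ b → (⟦ b Bool.≟ true ⟧ + X) * (⟦ b Bool.≟ false ⟧ + Y) ≡ X * Y + sideSize s (not b) (size L′)
    by-side true  = +-comm Y (X * Y)
    by-side false = trans (*-suc X Y) (+-comm X (X * Y))

  degreeSum-remove : ∀ {L v L′} → L ↭ v ∷ L′ → degreeSum L ≡ degreeSum L′ + 2 * deg v L′
  degreeSum-remove {L} {v} {L′} L↭ = begin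
    degreeSum L
      ≡⟨ ∑-cong (λ u → ∑-↭ (λ x → ⟦ adj? G u x ⟧) L↭) L ⟩
    doubleSum (adj? G) L (v ∷ L′)
      ≡⟨ ∑-↭ (λ u → ∑ (λ x → ⟦ adj? G u x ⟧) (v ∷ L′)) L↭ ⟩
    (⟦ adj? G v v ⟧ + deg v L′) + ∑ (λ u → ⟦ adj? G u v ⟧ + deg u L′) L′
      ≡⟨ cong₂ (λ a b → (a + deg v L′) + b) (⟦⟧-no (adj? G v v) (adj-irrefl G refl))
               (∑-+ (λ u → ⟦ adj? G u v ⟧) (λ u → deg u L′) L′) ⟩
    deg v L′ + (∑ (λ u → ⟦ adj? G u v ⟧) L′ + degreeSum L′)
      ≡⟨ cong (λ a → deg v L′ + (a + degreeSum L′))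
              (∑-cong (λ u → ⟦⟧-cong (adj? G u v) (adj? G v u) (adj-sym G) (adj-sym G)) L′) ⟩
    deg v L′ + (deg v L′ + degreeSum L′)
      ≡⟨ arrange (deg v L′) (degreeSum L′) ⟩
    degreeSum L′ + 2 * deg v L′ ∎
    where
    open ≡-Reasoning
    arrange : ∀ a b → a + (a + b) ≡ b + 2 * a
    arrange = solve-∀

  -- Any common upper bound `B` stands in for the maximum over the cuts. The summand `d` carries the
  -- degrees of the vertices removed so far, so that nothing has to be subtracted from `B`.
  Bound : ℕ → (Cut → ℕ) → List (Fin n) → Set
  Bound κ β L = ∀ d B → (∀ s → cutSize s (size L) + κ * β s + d ≤ B) →
                degreeSum L + 2 * d ≤ 2 * B

  -- The deleted pairs are charged to the bonus: there are at most `κ * (18 * κ)` of them, which is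
  -- at most `κ * β s` by `large`. The goal is a decidable inequality, so the double negation in
  -- `triangle-transversal` can be removed.
  poor-bound : ∀ κ β L → Unique L → ¬ Packing (Triangle L) (suc κ) → (∀ s → 18 * κ ≤ β s) →
               (∀ v → v ∈ L → ¬ Packing (Link L v) (suc (κ * 3))) → Bound κ β L
  poor-bound κ β L L! ¬M large poor d B bound = decidable-stable (_ ≤? _) λ k →
    triangle-transversal κ L ¬M poor λ (D , few , triangle-free) → k (begin
    degreeSum L + 2 * d
      ≤⟨ +-monoˡ-≤ (2 * d) (deletion L! D) ⟩
    doubleSum (kept? L D) L L + 2 * length D + 2 * d
      ≡⟨ arrange (doubleSum (kept? L D) L L) (length D) d ⟩
    doubleSum (kept? L D) L L + 2 * (length D + d)
      ≤⟨ triangle-free-bound (kept? L D) (kept-sym {L} {D}) (proper ∘ proj₁) triangle-free L (length D + d) B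
           (λ s → ≤-trans (≤-trans (+-monoʳ-≤ (cutSize s (size L)) (+-monoˡ-≤ d (few-enough s few)))
                                   (≤-reflexive (sym (+-assoc (cutSize s (size L)) (κ * β s) d))))
                          (bound s)) ⟩
    2 * B ∎)
    where
    open ≤-Reasoning
    arrange : ∀ a l d → a + 2 * l + 2 * d ≡ a + 2 * (l + d)
    arrange = solve-∀
    product : ∀ κ → κ * 3 * (κ * 3 * 2) ≡ κ * (18 * κ)
    product = solve-∀
    few-enough : ∀ s {l} → l ≤ κ * 3 * (κ * 3 * 2) → l ≤ κ * β s
    few-enough s few = ≤-trans few (≤-trans (≤-reflexive (product κ)) (*-monoʳ-≤ κ (large s)))

  -- The numbers `β s` stay fixed while `κ` and `L` shrink. The hypothesis on `slack` lets a single
  -- `β s` pay for the neighbours of a removed vertex on its own side of `s`, and it passes to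
  -- sublists.
  bound : ∀ κ β L → Unique L → ¬ Packing (Triangle L) (suc κ) → (∀ s → 18 * κ ≤ β s) →
          (∀ s h → slack s h L ≤ β s) → Bound κ β L
  -- For `κ = 0` a rich vertex is one with a single edge in its link, which already gives a
  -- forbidden triangle.
  bound zero    β L L! ¬M large small d B =
    poor-bound 0 β L L! ¬M large
      (λ v v∈L N → ¬M (add-triangle (λ ()) (λ ()) N (empty {Q = Triangle []}))) d B
  bound (suc κ) β L L! ¬M large small d B cuts = decidable-stable (_ ≤? _) λ k →
    ¬¬-excluded-middle {A = ∃[ v ] v ∈ L × Packing (Link L v) (suc (suc κ * 3))} λ where
      (no ¬rich) → k (poor-bound (suc κ) β L L! ¬M large (λ v v∈L N → ¬rich (v , v∈L , N)) d B cuts)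
      (yes (v , v∈L , N)) → k (rich v∈L N)
    where
    open ≤-Reasoning
    rich : ∀ {v} → v ∈ L → Packing (Link L v) (suc (suc κ * 3)) → degreeSum L + 2 * d ≤ 2 * B
    rich {v} v∈L N
      with L′ , L↭ ← remove v∈L
      with v∷L′!@(_ ∷ L′!) ← Unique-resp-↭ (setoid (Fin n)) (↭⇒↭ₛ L↭) L! = begin
      degreeSum L + 2 * d
        ≡⟨ cong (_+ 2 * d) (degreeSum-remove L↭) ⟩
      degreeSum L′ + 2 * deg v L′ + 2 * d
        ≡⟨ arrange (degreeSum L′) (deg v L′) d ⟩
      degreeSum L′ + 2 * (deg v L′ + d)
        ≤⟨ bound κ β L′ L′!
             (λ M → ¬M (add-triangle (λ x∈ → ∈-resp-↭ (↭-sym L↭) (there x∈))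
                                     (Unique[x∷xs]⇒x∉xs v∷L′!) N M))
             (λ s → ≤-trans (*-monoʳ-≤ 18 (n≤1+n κ)) (large s))
             small′ (deg v L′ + d) B cuts′ ⟩
      2 * B ∎
      where
      arrange : ∀ a l d → a + 2 * l + 2 * d ≡ a + 2 * (l + d)
      arrange = solve-∀
      small′ : ∀ s h → slack s h L′ ≤ β s
      small′ s h = ≤-trans (m≤n+m _ (sameSide s h (part v)))
        (≤-trans (≤-reflexive (sym (∑-↭ (sameSide s h ∘ part) L↭))) (small s h))
      shuffle : ∀ c y β′ k d → c + k + (y + β′ + d) ≡ c + y + (β′ + k) + d
      shuffle = solve-∀
      -- The degree splits as in `deg≤`: the opposite side is exactly what `cutSize` loses, and the
      -- slack is covered by the one copy of `β s` given up when `suc κ` drops to `κ`.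
      cuts′ : ∀ s → cutSize s (size L′) + κ * β s + (deg v L′ + d) ≤ B
      cuts′ s = begin
        c + κ * β s + (deg v L′ + d)
          ≤⟨ +-monoʳ-≤ (c + κ * β s) (+-monoˡ-≤ d (≤-trans (deg≤ s v L′) (+-monoʳ-≤ y (small′ s (part v))))) ⟩
        c + κ * β s + (y + β s + d)
          ≡⟨ shuffle c y (β s) (κ * β s) d ⟩
        c + y + suc κ * β s + d
          ≡⟨ cong (λ a → a + suc κ * β s + d) (cutSize-remove L↭ s) ⟨
        cutSize s (size L) + suc κ * β s + d
          ≤⟨ cuts s ⟩
        B ∎
        where
        c = cutSize s (size L′)
        y = sideSize s (not (side s (part v))) (size L′)

-- Edge counts and numerical estimates.

two-e≤ : ∀ {n} (G : Graph n) → 2 * e G ≤ doubleSum (adj? G) (allFin n) (allFin n)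
two-e≤ {n} G = begin
  e G + (e G + 0)
    ≡⟨ cong (e G +_) (+-identityʳ (e G)) ⟩
  e G + e G
    ≡⟨ cong₂ _+_ e≡ (trans e≡ (∑-comm edge (allFin n) (allFin n))) ⟩
  ∑ (λ u → ∑ (edge u) (allFin n)) (allFin n) + ∑ (λ u → ∑ (λ v → edge v u) (allFin n)) (allFin n)
    ≡⟨ ∑-+ (λ u → ∑ (edge u) (allFin n)) (λ u → ∑ (λ v → edge v u) (allFin n)) (allFin n) ⟨
  ∑ (λ u → ∑ (edge u) (allFin n) + ∑ (λ v → edge v u) (allFin n)) (allFin n)
    ≡⟨ ∑-cong (λ u → ∑-+ (edge u) (λ v → edge v u) (allFin n)) (allFin n) ⟨
  ∑ (λ u → ∑ (λ v → edge u v + edge v u) (allFin n)) (allFin n)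
    ≤⟨ ∑-mono (allFin n) (λ {u} _ → ∑-mono (allFin n) (λ {v} _ → one-orientation u v)) ⟩
  doubleSum (adj? G) (allFin n) (allFin n) ∎
  where
  open ≤-Reasoning
  edge : Fin n → Fin n → ℕ
  edge u v = ⟦ (u <? v) ×-dec adj? G u v ⟧
  e≡ : e G ≡ ∑ (λ u → ∑ (edge u) (allFin n)) (allFin n)
  e≡ = trans (length-filter-∑ _ (cartesianProduct (allFin n) (allFin n)))
             (∑-cartesianProduct (λ (u , v) → edge u v) (allFin n) (allFin n))
  one-orientation : ∀ u v → edge u v + edge v u ≤ ⟦ adj? G u v ⟧
  one-orientation u v =
    ⟦⟧-disjoint ((u <? v) ×-dec adj? G u v) ((v <? u) ×-dec adj? G v u) (adj? G u v)
      proj₂ (adj-sym G ∘ proj₂) (λ (u<v , _) (v<u , _) → <-asym u<v v<u)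

-- weight s · a bounds the number of vertices that lie on the side of a vertex v in the cut s but
-- outside the part of v.
weight : Cut → Fin 4 → ℕ
weight (star 0F)   = lookup (0 Vec.∷ 1 Vec.∷ 1 Vec.∷ 0 Vec.∷ Vec.[])
weight (star 1F)   = lookup (1 Vec.∷ 0 Vec.∷ 1 Vec.∷ 0 Vec.∷ Vec.[])
weight (star 2F)   = lookup (1 Vec.∷ 1 Vec.∷ 0 Vec.∷ 0 Vec.∷ Vec.[])
weight (star 3F)   = lookup (1 Vec.∷ 1 Vec.∷ 0 Vec.∷ 0 Vec.∷ Vec.[])
weight (pairing _) = lookup (1 Vec.∷ 0 Vec.∷ 0 Vec.∷ 0 Vec.∷ Vec.[])

prefix : (Fin 4 → ℕ) → Fin 4 → ℕ
prefix φ 0F = φ 0F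
prefix φ 1F = φ 0F + φ 1F
prefix φ 2F = φ 0F + φ 1F + φ 2F
prefix φ 3F = φ 0F + φ 1F + φ 2F + φ 3F

partSizes : ℕ → ℕ → ℕ → ℕ → Fin 4 → ℕ
partSizes n₁ n₂ n₃ n₄ = lookup (n₁ Vec.∷ n₂ Vec.∷ n₃ Vec.∷ n₄ Vec.∷ Vec.[])

-- Abel summation: for decreasing a, comparing the prefix sums of the weights is enough.
·-dominated : ∀ φ ψ → (∀ i → prefix φ i ≤ prefix ψ i) → ∀ w x y z →
              let a = partSizes (w + x + y + z) (w + x + y) (w + x) w in φ · a ≤ ψ · a
·-dominated φ ψ φ≤ψ w x y z = begin
  φ · a                                                                   ≡⟨ abel φ ⟩
  prefix φ 0F * z + prefix φ 1F * y + prefix φ 2F * x + prefix φ 3F * w   ≤⟨ mono ⟩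
  prefix ψ 0F * z + prefix ψ 1F * y + prefix ψ 2F * x + prefix ψ 3F * w   ≡⟨ abel ψ ⟨
  ψ · a                                                                   ∎
  where
  open ≤-Reasoning
  a = partSizes (w + x + y + z) (w + x + y) (w + x) w
  arrange : ∀ c₀ c₁ c₂ c₃ w x y z →
    c₀ * (w + x + y + z) + (c₁ * (w + x + y) + (c₂ * (w + x) + (c₃ * w + 0))) ≡
    c₀ * z + (c₀ + c₁) * y + (c₀ + c₁ + c₂) * x + (c₀ + c₁ + c₂ + c₃) * w
  arrange = solve-∀
  abel : ∀ c → c · a ≡ prefix c 0F * z + prefix c 1F * y + prefix c 2F * x + prefix c 3F * w
  abel c = arrange (c 0F) (c 1F) (c 2F) (c 3F) w x y z
  mono : prefix φ 0F * z + prefix φ 1F * y + prefix φ 2F * x + prefix φ 3F * w ≤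
         prefix ψ 0F * z + prefix ψ 1F * y + prefix ψ 2F * x + prefix ψ 3F * w
  mono = +-mono-≤ (+-mono-≤ (+-mono-≤ (*-monoˡ-≤ z (φ≤ψ 0F)) (*-monoˡ-≤ y (φ≤ψ 1F)))
                            (*-monoˡ-≤ x (φ≤ψ 2F))) (*-monoˡ-≤ w (φ≤ψ 3F))

·-monoʳ : ∀ φ {a b} → (∀ i → a i ≤ b i) → φ · a ≤ φ · b
·-monoʳ φ a≤b = ∑-mono (allFin 4) (λ {i} _ → *-monoʳ-≤ (φ i) (a≤b i))

-- Finitely many cases, settled by evaluation. Entrywise the comparison can fail: for `star 0F` and
-- `h = 1F` the marked parts are `2F` and `3F`, whereas the weights sit at `1F` and `2F`.
sameSide-prefix : ∀ s h i → prefix (sameSide s h) i ≤ prefix (weight s) i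
sameSide-prefix (star c)    = from-yes
  (all? λ c → all? λ h → all? λ i → prefix (sameSide (star c) h) i ≤? prefix (weight (star c)) i) c
sameSide-prefix (pairing j) = from-yes
  (all? λ j → all? λ h → all? λ i → prefix (sameSide (pairing j) h) i ≤? prefix (weight (pairing j)) i) j

-- Links the lower bound on the smallest part with the requirement `18 * κ ≤ β s`. Splitting off
-- `κ = 0` makes all coefficients of the difference of the two sides positive.
18κ≤6[1+κ]² : ∀ κ → 18 * κ ≤ 6 * suc κ ^ 2
18κ≤6[1+κ]² zero    = z≤n
18κ≤6[1+κ]² (suc κ) = ≤-trans (m≤m+n _ (6 * κ * κ + 6 * κ + 6)) (≤-reflexive (expand κ))
  where
  expand : ∀ κ → 18 * (1 + κ) + (6 * κ * κ + 6 * κ + 6) ≡ 6 * ((2 + κ) * ((2 + κ) * 1))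
  expand = solve-∀

∑-allFin-+ : ∀ {A : Set} m n (φ : A → ℕ) c (h : Fin n → A) →
  ∑ (φ ∘ [ const c , h ]′ ∘ splitAt m) (allFin (m + n)) ≡ m * φ c + ∑ (φ ∘ h) (allFin n)
∑-allFin-+ m n φ c h = begin
  ∑ f (allFin (m + n))
    ≡⟨ cong sum (map-tabulate id f) ⟩
  sum (tabulate f)
    ≡⟨ sum-tabulate-+ m f ⟩
  sum (tabulate (f ∘ (_↑ˡ n))) + sum (tabulate (f ∘ (m ↑ʳ_)))
    ≡⟨ cong₂ (λ a b → sum a + sum b) (map-tabulate id (f ∘ (_↑ˡ n))) (map-tabulate id (f ∘ (m ↑ʳ_))) ⟨
  ∑ (f ∘ (_↑ˡ n)) (allFin m) + ∑ (f ∘ (m ↑ʳ_)) (allFin n)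
    ≡⟨ cong₂ _+_ (∑-cong (λ i → cong (φ ∘ [ const c , h ]′) (splitAt-↑ˡ m i n)) (allFin m))
                 (∑-cong (λ i → cong (φ ∘ [ const c , h ]′) (splitAt-↑ʳ m n i)) (allFin n)) ⟩
  ∑ (λ _ → φ c) (allFin m) + ∑ (φ ∘ h) (allFin n)
    ≡⟨ cong (_+ ∑ (φ ∘ h) (allFin n)) (∑-allFin-const m (φ c)) ⟩
  m * φ c + ∑ (φ ∘ h) (allFin n) ∎
  where
  open ≡-Reasoning
  f : Fin (m + n) → ℕ
  f = φ ∘ [ const c , h ]′ ∘ splitAt m
  sum-tabulate-+ : ∀ m {n} (f : Fin (m + n) → ℕ) →
    sum (tabulate f) ≡ sum (tabulate (f ∘ (_↑ˡ n))) + sum (tabulate (f ∘ (m ↑ʳ_)))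
  sum-tabulate-+ zero    f = refl
  sum-tabulate-+ (suc m) f = trans (cong (f zero +_) (sum-tabulate-+ m (f ∘ suc))) (sym (+-assoc (f zero) _ _))

-- Writing the sizes through their differences, with `n₄ = κ + v`, turns each inequality into a
-- polynomial identity with an explicit non-negative excess. Stars are compared with the second term
-- of `g` and pairings with the first; the excess is `0` for `star 0F` and `pairing 2F`, which give
-- the two terms. In the other stars the bonus may exceed that of `g`, and the excess stays
-- non-negative because `κ ≤ n₄`.
cut≤g : ∀ κ v x y z s →
        let n₄ = κ + v ; n₃ = n₄ + x ; n₂ = n₃ + y ; n₁ = n₂ + z ; a = partSizes n₁ n₂ n₃ n₄ in
        cutSize s a + κ * (weight s · a) ≤ g (suc κ) n₁ n₂ n₃ n₄
cut≤g κ v x y z (star 0F) =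
  ≤-trans (m≤m+n _ _) (≤-trans (≤-reflexive (excess κ v x y z)) (m≤n⊔m _ _))
  where
  excess : ∀ κ v x y z → let n₄ = κ + v ; n₃ = n₄ + x ; n₂ = n₃ + y ; n₁ = n₂ + z in
    (1 * n₁ + (0 * n₂ + (0 * n₃ + (0 * n₄ + 0)))) *
    (0 * n₁ + (1 * n₂ + (1 * n₃ + (1 * n₄ + 0)))) +
    κ * (0 * n₁ + (1 * n₂ + (1 * n₃ + (0 * n₄ + 0)))) +
    0 ≡ n₁ * (n₂ + n₃ + n₄) + κ * (n₂ + n₃)
  excess = solve-∀
cut≤g κ v x y z (star 1F) =
  ≤-trans (m≤m+n _ _) (≤-trans (≤-reflexive (excess κ v x y z)) (m≤n⊔m _ _))
  where
  excess : ∀ κ v x y z → let n₄ = κ + v ; n₃ = n₄ + x ; n₂ = n₃ + y ; n₁ = n₂ + z in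
    (0 * n₁ + (1 * n₂ + (0 * n₃ + (0 * n₄ + 0)))) *
    (1 * n₁ + (0 * n₂ + (1 * n₃ + (1 * n₄ + 0)))) +
    κ * (1 * n₁ + (0 * n₂ + (1 * n₃ + (0 * n₄ + 0)))) +
    (z * (n₃ + v)) ≡ n₁ * (n₂ + n₃ + n₄) + κ * (n₂ + n₃)
  excess = solve-∀
cut≤g κ v x y z (star 2F) =
  ≤-trans (m≤m+n _ _) (≤-trans (≤-reflexive (excess κ v x y z)) (m≤n⊔m _ _))
  where
  excess : ∀ κ v x y z → let n₄ = κ + v ; n₃ = n₄ + x ; n₂ = n₃ + y ; n₁ = n₂ + z in
    (0 * n₁ + (0 * n₂ + (1 * n₃ + (0 * n₄ + 0)))) *
    (1 * n₁ + (1 * n₂ + (0 * n₃ + (1 * n₄ + 0)))) +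
    κ * (1 * n₁ + (1 * n₂ + (0 * n₃ + (0 * n₄ + 0)))) +
    ((y + z) * (n₂ + v)) ≡ n₁ * (n₂ + n₃ + n₄) + κ * (n₂ + n₃)
  excess = solve-∀
cut≤g κ v x y z (star 3F) =
  ≤-trans (m≤m+n _ _) (≤-trans (≤-reflexive (excess κ v x y z)) (m≤n⊔m _ _))
  where
  excess : ∀ κ v x y z → let n₄ = κ + v ; n₃ = n₄ + x ; n₂ = n₃ + y ; n₁ = n₂ + z in
    (0 * n₁ + (0 * n₂ + (0 * n₃ + (1 * n₄ + 0)))) *
    (1 * n₁ + (1 * n₂ + (1 * n₃ + (0 * n₄ + 0)))) +
    κ * (1 * n₁ + (1 * n₂ + (0 * n₃ + (0 * n₄ + 0)))) +
    ((x + y + z) * (n₂ + v + x) + κ * x) ≡ n₁ * (n₂ + n₃ + n₄) + κ * (n₂ + n₃)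
  excess = solve-∀
cut≤g κ v x y z (pairing 0F) =
  ≤-trans (m≤m+n _ _) (≤-trans (≤-reflexive (excess κ v x y z)) (m≤m⊔n _ _))
  where
  excess : ∀ κ v x y z → let n₄ = κ + v ; n₃ = n₄ + x ; n₂ = n₃ + y ; n₁ = n₂ + z in
    (1 * n₁ + (1 * n₂ + (0 * n₃ + (0 * n₄ + 0)))) *
    (0 * n₁ + (0 * n₂ + (1 * n₃ + (1 * n₄ + 0)))) +
    κ * (1 * n₁ + (0 * n₂ + (0 * n₃ + (0 * n₄ + 0)))) +
    ((y + z) * (x + y)) ≡ (n₁ + n₄) * (n₂ + n₃) + κ * n₁
  excess = solve-∀
cut≤g κ v x y z (pairing 1F) =
  ≤-trans (m≤m+n _ _) (≤-trans (≤-reflexive (excess κ v x y z)) (m≤m⊔n _ _))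
  where
  excess : ∀ κ v x y z → let n₄ = κ + v ; n₃ = n₄ + x ; n₂ = n₃ + y ; n₁ = n₂ + z in
    (1 * n₁ + (0 * n₂ + (1 * n₃ + (0 * n₄ + 0)))) *
    (0 * n₁ + (1 * n₂ + (0 * n₃ + (1 * n₄ + 0)))) +
    κ * (1 * n₁ + (0 * n₂ + (0 * n₃ + (0 * n₄ + 0)))) +
    (z * x) ≡ (n₁ + n₄) * (n₂ + n₃) + κ * n₁
  excess = solve-∀
cut≤g κ v x y z (pairing 2F) =
  ≤-trans (m≤m+n _ _) (≤-trans (≤-reflexive (excess κ v x y z)) (m≤m⊔n _ _))
  where
  excess : ∀ κ v x y z → let n₄ = κ + v ; n₃ = n₄ + x ; n₂ = n₃ + y ; n₁ = n₂ + z in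
    (1 * n₁ + (0 * n₂ + (0 * n₃ + (1 * n₄ + 0)))) *
    (0 * n₁ + (1 * n₂ + (1 * n₃ + (0 * n₄ + 0)))) +
    κ * (1 * n₁ + (0 * n₂ + (0 * n₃ + (0 * n₄ + 0)))) +
    0 ≡ (n₁ + n₄) * (n₂ + n₃) + κ * n₁
  excess = solve-∀

-- From the induction to the bound by `g`.

-- Part sizes are bounded from above rather than prescribed, so that the statement also covers
-- subgraphs of `K` that miss some vertices; cut sizes and slacks are monotone in the part sizes.
edge-bound : ∀ κ v x y z →
  let n₄ = κ + v ; n₃ = n₄ + x ; n₂ = n₃ + y ; n₁ = n₂ + z in
  6 * suc κ ^ 2 ≤ n₄ →
  ∀ {n} (G : Graph n) (part : Fin n → Fin 4) → (∀ {u v} → Adj G u v → part u ≢ part v) →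
  (∀ i → Parts.size part (allFin n) i ≤ partSizes n₁ n₂ n₃ n₄ i) →
  (suc κ K₃) -Free G → e G ≤ g (suc κ) n₁ n₂ n₃ n₄
edge-bound κ v x y z n₄-large {n} G part proper small free = *-cancelˡ-≤ 2 (begin
  2 * e G                       ≤⟨ two-e≤ G ⟩
  degreeSum (allFin n)          ≡⟨ +-identityʳ _ ⟨
  degreeSum (allFin n) + 2 * 0  ≤⟨ bound κ β (allFin n) (allFin⁺ n) (free ∘ packing⇒⊑) β-large slack≤β 0 _ cuts ⟩
  2 * g (suc κ) n₁ n₂ n₃ n₄     ∎)
  where
  open ≤-Reasoning
  open Triangles G
  open Parts part
  open Induction G part proper
  n₄ = κ + v
  n₃ = n₄ + x
  n₂ = n₃ + y
  n₁ = n₂ + z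
  a : Fin 4 → ℕ
  a = partSizes n₁ n₂ n₃ n₄
  β : Cut → ℕ
  β s = weight s · a
  ≤n₁ : 18 * κ ≤ n₁
  ≤n₁ = ≤-trans (18κ≤6[1+κ]² κ) (≤-trans n₄-large (≤-trans (m≤m+n n₄ x) (≤-trans (m≤m+n n₃ y) (m≤m+n n₂ z))))
  ≤n₂ : 18 * κ ≤ n₂
  ≤n₂ = ≤-trans (18κ≤6[1+κ]² κ) (≤-trans n₄-large (≤-trans (m≤m+n n₄ x) (m≤m+n n₃ y)))
  β-large : ∀ s → 18 * κ ≤ β s
  -- Every weight vector has a `1` at `0F`, apart from that of `star 0F`, whose first `1` is at
  -- `1F`.
  β-large (star 0F)   = ≤-trans ≤n₂ (≤-trans (m≤m+n n₂ 0) (m≤m+n (n₂ + 0) _))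
  β-large (star 1F)   = ≤-trans ≤n₁ (≤-trans (m≤m+n n₁ 0) (m≤m+n (n₁ + 0) _))
  β-large (star 2F)   = ≤-trans ≤n₁ (≤-trans (m≤m+n n₁ 0) (m≤m+n (n₁ + 0) _))
  β-large (star 3F)   = ≤-trans ≤n₁ (≤-trans (m≤m+n n₁ 0) (m≤m+n (n₁ + 0) _))
  β-large (pairing _) = ≤-trans ≤n₁ (≤-trans (m≤m+n n₁ 0) (m≤m+n (n₁ + 0) _))
  slack≤β : ∀ s h → slack s h (allFin n) ≤ β s
  slack≤β s h = begin
    slack s h (allFin n)                 ≡⟨ ∑-size (sameSide s h) (allFin n) ⟩
    sameSide s h · size (allFin n)       ≤⟨ ·-monoʳ (sameSide s h) small ⟩
    sameSide s h · a                     ≤⟨ ·-dominated (sameSide s h) (weight s) (sameSide-prefix s h) n₄ x y z ⟩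
    β s                                  ∎
  cuts : ∀ s → cutSize s (size (allFin n)) + κ * β s + 0 ≤ g (suc κ) n₁ n₂ n₃ n₄
  cuts s = begin
    cutSize s (size (allFin n)) + κ * β s + 0 ≡⟨ +-identityʳ _ ⟩
    cutSize s (size (allFin n)) + κ * β s
      ≤⟨ +-monoˡ-≤ (κ * β s) (*-mono-≤ (·-monoʳ (on s true) small) (·-monoʳ (on s false) small)) ⟩
    cutSize s a + κ * β s ≤⟨ cut≤g κ v x y z s ⟩
    g (suc κ) n₁ n₂ n₃ n₄ ∎

-- Subgraphs of the complete 4-partite graph and the theorem.

block-size : ∀ n₁ n₂ n₃ n₄ i →
  ∑ (λ u → ⟦ block n₁ n₂ n₃ n₄ u ≟ i ⟧) (allFin (n₁ + (n₂ + (n₃ + n₄)))) ≡ partSizes n₁ n₂ n₃ n₄ i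
block-size n₁ n₂ n₃ n₄ i = trans
  (trans (∑-allFin-+ n₁ _ φ 0F _) (cong (n₁ * φ 0F +_)
  (trans (∑-allFin-+ n₂ _ φ 1F _) (cong (n₂ * φ 1F +_)
  (trans (∑-allFin-+ n₃ _ φ 2F _) (cong (n₃ * φ 2F +_) (∑-allFin-const n₄ (φ 3F))))))))
  (by-part i)
  where
  φ : Fin 4 → ℕ
  φ j = ⟦ j ≟ i ⟧
  by-part : ∀ i → n₁ * ⟦ 0F ≟ i ⟧ + (n₂ * ⟦ 1F ≟ i ⟧ + (n₃ * ⟦ 2F ≟ i ⟧ + n₄ * ⟦ 3F ≟ i ⟧)) ≡ partSizes n₁ n₂ n₃ n₄ i
  by-part 0F = select n₁ n₂ n₃ n₄
    where
    select : ∀ a b c d → a * 1 + (b * 0 + (c * 0 + d * 0)) ≡ a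
    select = solve-∀
  by-part 1F = select n₁ n₂ n₃ n₄
    where
    select : ∀ a b c d → a * 0 + (b * 1 + (c * 0 + d * 0)) ≡ b
    select = solve-∀
  by-part 2F = select n₁ n₂ n₃ n₄
    where
    select : ∀ a b c d → a * 0 + (b * 0 + (c * 1 + d * 0)) ≡ c
    select = solve-∀
  by-part 3F = select n₁ n₂ n₃ n₄
    where
    select : ∀ a b c d → a * 0 + (b * 0 + (c * 0 + d * 1)) ≡ d
    select = solve-∀

subgraph-size : ∀ {n₁ n₂ n₃ n₄ p} {G : Graph p} (G⊑K : G ⊑ K n₁ n₂ n₃ n₄) → ∀ i →
  Parts.size (block n₁ n₂ n₃ n₄ ∘ _⊑_.embed G⊑K) (allFin p) i ≤ partSizes n₁ n₂ n₃ n₄ i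
subgraph-size {n₁} {n₂} {n₃} {n₄} {p} G⊑K i = begin
  Parts.size (block n₁ n₂ n₃ n₄ ∘ embed) (allFin p) i
    ≡⟨ length-filter-∑ (λ v → block n₁ n₂ n₃ n₄ (embed v) ≟ i) (allFin p) ⟩
  ∑ (in-part ∘ embed) (allFin p)
    ≡⟨ ∑-map in-part embed (allFin p) ⟨
  ∑ in-part (map embed (allFin p))
    ≤⟨ ∑-⊆ in-part (map⁺ injective (allFin⁺ p)) (λ _ → ∈-allFin _) ⟩
  ∑ in-part (allFin _)
    ≡⟨ block-size n₁ n₂ n₃ n₄ i ⟩
  partSizes n₁ n₂ n₃ n₄ i ∎
  where
  open ≤-Reasoning
  open _⊑_ G⊑K
  in-part : Fin (n₁ + (n₂ + (n₃ + n₄))) → ℕ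
  in-part u = ⟦ block n₁ n₂ n₃ n₄ u ≟ i ⟧

κ≤6[1+κ]² : ∀ κ → κ ≤ 6 * suc κ ^ 2
κ≤6[1+κ]² κ = ≤-trans (m≤m+n κ (17 * κ)) (18κ≤6[1+κ]² κ)

theorem1p3 : ∀ (k : ℕ) → k ≥ 1 →
    ∃[ N₀ ] (∀ (n₁ n₂ n₃ n₄ : ℕ) →
    n₁ ≥ n₂ → n₂ ≥ n₃ → n₃ ≥ n₄ → n₄ ≥ 6 * k ^ 2 →
    n₁ + n₂ + n₃ + n₄ ≥ N₀ →
    (∀ {n} (G : Graph n) → FourPartite G n₁ n₂ n₃ n₄ → (k K₃) -Free G →
    e G ≤ g k n₁ n₂ n₃ n₄)
    × (∀ (x : ℕ) → IsEx (K n₁ n₂ n₃ n₄) (k K₃) x → x ≤ g k n₁ n₂ n₃ n₄))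
theorem1p3 (suc κ) _ = 0 , λ n₁ n₂ n₃ n₄ n₂≤n₁ n₃≤n₂ n₄≤n₃ n₄-large _ →
  -- The witnesses are the differences of consecutive sizes, and of `n₄` and `κ`, that parametrise
  -- `cut≤g`.
  let v , n₄≡ = m≤n⇒∃[o]m+o≡n (≤-trans (κ≤6[1+κ]² κ) n₄-large)
      x , n₃≡ = m≤n⇒∃[o]m+o≡n n₄≤n₃
      y , n₂≡ = m≤n⇒∃[o]m+o≡n n₃≤n₂
      z , n₁≡ = m≤n⇒∃[o]m+o≡n n₂≤n₁
  in bounds κ v x y z n₄≡ n₃≡ n₂≡ n₁≡ n₄-large
  where
  bounds : ∀ κ v x y z {n₁ n₂ n₃ n₄} →
    κ + v ≡ n₄ → n₄ + x ≡ n₃ → n₃ + y ≡ n₂ → n₂ + z ≡ n₁ → n₄ ≥ 6 * suc κ ^ 2 →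
    (∀ {n} (G : Graph n) → FourPartite G n₁ n₂ n₃ n₄ → (suc κ K₃) -Free G →
    e G ≤ g (suc κ) n₁ n₂ n₃ n₄)
    × (∀ x → IsEx (K n₁ n₂ n₃ n₄) (suc κ K₃) x → x ≤ g (suc κ) n₁ n₂ n₃ n₄)
  bounds κ v x y z refl refl refl refl n₄-large =
    (λ G four free → let open FourPartite four in
      edge-bound κ v x y z n₄-large G part proper (λ i → ≤-reflexive (sizes i)) free) ,
    -- The value `x` is attained by some `G`, which receives its parts from `K` through the
    -- embedding.
    (λ { _ ((_ , G , G⊑K , free , refl) , _) →
      edge-bound κ v x y z n₄-large G _ (_⊑_.preserves G⊑K) (subgraph-size G⊑K) free })
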